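{- Let $m$ be an odd square-free positive integer and $p$ a prime with $\gcd(p,m)=1$; put $r=\mathrm{rem}(p,m)$ and $q=\mathrm{quo}(p,m)$. Then for all integers $i,j$ with $0\leq i\leq\varphi(m)-1$ and $0\leq j\leq q$, \[ f_{m,p,i,j}= \begin{cases} -\mathcal{R}_{ir}\left(\Psi_{m}\cdot\mathcal{E}_{r}\mathcal{T}_{i+1}\Phi_{m}\right) & 0\leq j\leq q-1,\\ \mathcal{T}_{r}f_{m,p,i,0} & j=q. \end{cases} \]
   Context: $\Phi_n$ is the $n$-th cyclotomic polynomial, $\varphi$ is Euler's totient function, and $\Psi_m(x)=(x^m-1)/\Phi_m(x)$ is the $m$-th inverse cyclotomic polynomial. For integers $a,b$ with $b>0$, $\mathrm{rem}(a,b)$ denotes the non-negative remainder and $\mathrm{quo}(a,b)$ the quotient; for polynomials, $\mathrm{rem}(f,g)$ denotes the polynomial remainder. Blocks: write (uniquely) $\Phi_{mp}(x)=\sum_{i\geq0}f_{m,p,i}(x)\,x^{ip}$ with $\deg f_{m,p,i}<p$, and $f_{m,p,i}(x)=\sum_{j\geq0}f_{m,p,i,j}(x)\,x^{jm}$ with $\deg f_{m,p,i,j}<m$. Operations on polynomials $f$ (with $s$ an integer): $\mathcal{T}_s f=\mathrm{rem}(f,x^s)$ ("truncate", $s\ge 0$); $\mathcal{R}_s f=\mathrm{rem}\left(x^{m-\mathrm{rem}(s,m)}f,\;x^m-1\right)$ ("rotate"); $\mathcal{E}_s f=f\left(x^{\mathrm{rem}(s,m)}\right)$ ("expand"). -}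

module Defs where

open import Data.Nat as ℕ using (ℕ; zero; suc; _∸_; NonZero; _%_)
open import Data.Nat.Divisibility using (_∣?_)
open import Data.Nat.Coprimality using (coprime?)
open import Data.Integer as ℤ using (ℤ; +_; -_)
open import Data.List using (List; []; _∷_; length; filter; map; upTo; reverse; take; drop; foldr; replicate; _++_)
open import Relation.Binary.PropositionalEquality using (_≡_)

-- Polynomials over ℤ: coefficient lists, lowest degree first.
-- Trailing zeros are allowed; polynomials are compared via coefficients.

Poly : Set
Poly = List ℤ

coeff : Poly → ℕ → ℤ
coeff []       _       = + 0
coeff (c ∷ _)  zero    = c
coeff (_ ∷ cs) (suc k) = coeff cs k

infix 4 _≈ₚ_
_≈ₚ_ : Poly → Poly → Set
f ≈ₚ g = ∀ k → coeff f k ≡ coeff g k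

infixl 6 _+ₚ_ _-ₚ_
infixl 7 _*ₚ_

_+ₚ_ : Poly → Poly → Poly
[]       +ₚ g        = g
(a ∷ f)  +ₚ []       = a ∷ f
(a ∷ f)  +ₚ (b ∷ g)  = (a ℤ.+ b) ∷ (f +ₚ g)

negₚ : Poly → Poly
negₚ = map -_

_-ₚ_ : Poly → Poly → Poly
f -ₚ g = f +ₚ negₚ g

scale : ℤ → Poly → Poly
scale c = map (c ℤ.*_)

_*ₚ_ : Poly → Poly → Poly
[]      *ₚ g = []
(a ∷ f) *ₚ g = scale a g +ₚ (+ 0 ∷ (f *ₚ g))

constₚ : ℤ → Poly
constₚ c = c ∷ []

oneₚ : Poly
oneₚ = constₚ (+ 1)

xpow : ℕ → Poly
xpow k = replicate k (+ 0) ++ (+ 1 ∷ [])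

xpowMinus1 : ℕ → Poly
xpowMinus1 n = xpow n -ₚ oneₚ

prodₚ : List Poly → Poly
prodₚ = foldr _*ₚ_ oneₚ

composeₚ : Poly → Poly → Poly
composeₚ f g = foldr (λ c acc → constₚ c +ₚ (g *ₚ acc)) [] f

dropLeadingZeros : List ℤ → List ℤ
dropLeadingZeros []            = []
dropLeadingZeros (+ 0 ∷ xs)    = dropLeadingZeros xs
dropLeadingZeros (x ∷ xs)      = x ∷ xs

trim : Poly → Poly
trim f = reverse (dropLeadingZeros (reverse f))

subPrefix : List ℤ → List ℤ → List ℤ
subPrefix []       ys       = ys
subPrefix (_ ∷ _)  []       = []
subPrefix (x ∷ xs) (y ∷ ys) = (y ℤ.- x) ∷ subPrefix xs ys

-- long division, highest-degree-first lists; divisor is 1·x^k + (bs);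
-- returns the quotient (highest degree first); fuel = number of steps
divH : ℕ → List ℤ → List ℤ → List ℤ
divH zero    _       _  = []
divH (suc f) []      bs = []
divH (suc f) (c ∷ a) bs = c ∷ divH f (subPrefix (map (c ℤ.*_) bs) a) bs

-- quotient of f by the monic polynomial g
quotₚ : Poly → Poly → Poly
quotₚ f g with reverse (trim g)
... | []       = []
... | (_ ∷ bs) = reverse (divH (length f ∸ length bs) (reverse f) bs)

remₚ : Poly → Poly → Poly
remₚ f g = f -ₚ g *ₚ quotₚ f g

-- Cyclotomic polynomials, defined by  x^n - 1 = ∏_{d ∣ n} Φ_d ,
-- i.e. Φ_n = (x^n - 1) / ∏_{d ∣ n, d < n} Φ_d.  The fuel argument only
-- makes the recursion structural (fuel > n suffices).

properDivisors : ℕ → List ℕ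
properDivisors n = filter (λ d → d ∣? n) (map suc (upTo (n ∸ 1)))

cycF : ℕ → ℕ → Poly
cycF zero    n = oneₚ
cycF (suc f) n = quotₚ (xpowMinus1 n) (prodₚ (map (cycF f) (properDivisors n)))

Φ : ℕ → Poly
Φ n = cycF (suc n) n

Ψ : ℕ → Poly
Ψ m = quotₚ (xpowMinus1 m) (Φ m)

φ : ℕ → ℕ
φ n = length (filter (λ k → coprime? k n) (map suc (upTo n)))

-- Blocks: f = Σ_i block f s i · x^{i s}, deg (block f s i) < s.

block : Poly → ℕ → ℕ → Poly
block f s i = take s (drop (i ℕ.* s) f)

fblock : ℕ → ℕ → ℕ → Poly
fblock m p i = block (Φ (m ℕ.* p)) p i

fblock2 : ℕ → ℕ → ℕ → ℕ → Poly
fblock2 m p i j = block (fblock m p i) m j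

𝒯 : ℕ → Poly → Poly
𝒯 s f = remₚ f (xpow s)

ℛ : (m : ℕ) .{{_ : NonZero m}} → ℕ → Poly → Poly
ℛ m s f = remₚ (xpow (m ∸ (s % m)) *ₚ f) (xpowMinus1 m)

ℰ : (m : ℕ) .{{_ : NonZero m}} → ℕ → Poly → Poly
ℰ m s f = composeₚ f (xpow (s % m))

{-# OPTIONS --safe #-}
-- Φ_{mp}(x) = Φ_m(x^p) / Φ_m(x) and Φ_m Ψ_m = x^m − 1, so Φ_{mp} (x^m − 1) = Φ_m(x^p) Ψ_m.  Expanding
-- 1 / (x^m − 1), the coefficient of x^n in Φ_{mp} is minus the sum of a_s b_t over the coefficients a_s
-- of Φ_m and b_t of Ψ_m with s p + t ≤ n and s p + t ≡ n (mod m).  As deg Ψ_m < m, every s with s p ≤ n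
-- contributes exactly one t; so for n = i p + j m + k inside block i the sum runs over all s ≤ i, and
-- depends on n only modulo m, hence not on j.
--
-- A polynomial is identified with the linear functional s ↦ Σ_e f_e s(e) on sequences s : ℕ → ℤ.
-- Products, substitutions of x^p, and coefficient extraction modulo x^m − 1 then become statements about
-- the sequences alone.
--
-- Since Φ_n is defined by long division, the divisions must be shown to be exact.  For a ≠ b the ideal
-- generated by Φ_a and Φ_b contains a nonzero integer, and a monic polynomial that divides a nonzero
-- integer multiple of F divides F; so the product of the Φ_d over proper divisors d of n divides x^n − 1.
module Submission where

open import Defs
open import Data.Nat using (ℕ; NonZero; _*_; _+_; _∸_; _≤_; _<_; _/_; _%_)
open import Data.Nat.Divisibility using (_∣_)
open import Data.Nat.Primality using (Prime)
open import Data.Nat.GCD using (gcd)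
open import Data.Product using (_×_)
open import Relation.Binary.PropositionalEquality using (_≡_)
open import Relation.Nullary using (¬_)

open import Algebra.Bundles using (CommutativeRing)
open import Data.Bool using (if_then_else_)
import Data.Integer as ℤ hiding (+_)
open import Data.Integer using (ℤ; +_; 0ℤ; 1ℤ)
import Data.Integer.Properties as ℤ
open import Data.Integer.Tactic.RingSolver using (solve-∀)
open import Data.List using (List; []; _∷_; _++_; length; map; filter; upTo; reverse; take; drop)
open import Data.List.Membership.Propositional using (_∈_)
open import Data.List.Membership.Propositional.Properties
  using (∈-++⁺ˡ; ∈-++⁺ʳ; ∈-++⁻; ∈-filter⁺; ∈-filter⁻; ∈-map⁺; ∈-map⁻; ∈-upTo⁺; ∈-upTo⁻)
open import Data.List.Membership.Propositional.Properties.WithK using (unique∧set⇒bag)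
import Data.List.Properties as List
open import Data.List.Relation.Binary.BagAndSetEquality using (∼bag⇒↭)
open import Data.List.Relation.Binary.Permutation.Propositional using (_↭_)
open import Data.List.Relation.Unary.All as All using (All; []; _∷_)
import Data.List.Relation.Unary.All.Properties as All
open import Data.List.Relation.Unary.AllPairs using (AllPairs; []; _∷_)
import Data.List.Relation.Unary.AllPairs.Properties as AllPairs
open import Data.List.Relation.Unary.Any using (here; there)
open import Data.List.Relation.Unary.Unique.Propositional using (Unique)
import Data.List.Relation.Unary.Unique.Propositional.Properties as Unique
open import Data.Maybe using (Maybe; just; nothing)
open import Data.Nat as ℕ using (zero; suc; pred; z≤n; s≤s)
open import Data.Nat.Coprimality using (Coprime; coprime-divisor)
open import Data.Nat.Divisibility
  using (_∣?_; divides; 0∣⇒≡0; ∣1⇒≡1; ∣⇒≤; ∣-refl; ∣-trans; m∣m*n; ∣m⇒∣m*n; *-monoˡ-∣; *-cancelʳ-∣)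
open import Data.Nat.DivMod
open import Data.Nat.GCD using (gcd-GCD; gcd-comm; gcd-greatest; gcd[m,n]∣m; gcd[m,n]∣n; module Bézout)
open import Data.Nat.Induction using (<-rec)
open import Data.Nat.ListAction using (product)
open import Data.Nat.Primality using (prime⇒irreducible; prime⇒nonZero; prime⇒nonTrivial; ¬prime[1])
open import Data.Nat.Primality.Factorisation using (factorise; module PrimeFactorisation)
import Data.Nat.Properties as ℕ
import Data.Nat.Tactic.RingSolver as ℕ-Solver
open import Data.Product using (∃; ∃₂; _,_; proj₁; proj₂)
open import Data.Sum using (_⊎_; inj₁; inj₂; [_,_]′)
open import Function using (_∘_; id; mk⇔)
open import Level using (0ℓ)
open import Relation.Binary.Definitions using (tri<; tri≈; tri>)
open import Relation.Binary.PropositionalEquality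
  using (_≢_; refl; sym; trans; cong; cong₂; subst; subst₂; module ≡-Reasoning)
open import Relation.Nullary using (Dec; yes; no; does; contradiction; ¬?)
open import Relation.Nullary.Decidable using (_×-dec_)
open import Tactic.RingSolver.Core.AlmostCommutativeRing using (AlmostCommutativeRing; fromCommutativeRing)
open import Data.List.Membership.DecPropositional ℕ._≟_ using (_∈?_)

-- Coefficient lists have no normal form, so they are compared through all test sequences; testing
-- on `δ k` recovers each coefficient, so nothing is lost. The gain is that an operator on
-- polynomials is replaced by its transpose on sequences. Two sequences carry the theorem:
-- `residueBelow n` inverts multiplication by x^m - 1 up to sign, and `residue k` computes modulo
-- x^m - 1. The core of the argument is that, after the rotation, they agree at s p + t for s ≤ i
-- and t < m.
--
-- The bound deg Ψ_m < m amounts to deg Φ_m > 0. It is read off by comparing degrees in Φ_kp(x)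
-- Φ_k(x) = Φ_k(x^p), with p ∤ k, one prime factor of m at a time; squarefreeness supplies p ∤ k.
-- The same identity with k = m gives the quotient formula for Φ_mp.
--
-- The nonzero integers in the exactness argument are unavoidable: x - 1 and x + 1 generate 2 but
-- not 1 over ℤ. Monicity is what allows such an integer to be cancelled again.

-- Polynomials as linear functionals on sequences

⟪_,_⟫ : Poly → (ℕ → ℤ) → ℤ
⟪ []    , s ⟫ = + 0
⟪ c ∷ f , s ⟫ = c ℤ.* s 0 ℤ.+ ⟪ f , s ∘ suc ⟫

-- Only exponents in the support of `f` contribute. The choice offered at each exponent is how
-- degree bounds enter later: beyond the degree the two sequences may differ freely.
pairing-congʳ-supp : ∀ f {s t} → (∀ e → coeff f e ≡ + 0 ⊎ s e ≡ t e) → ⟪ f , s ⟫ ≡ ⟪ f , t ⟫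
pairing-congʳ-supp []      h = refl
pairing-congʳ-supp (c ∷ f) h with h 0
... | inj₁ refl = cong (ℤ._+_ 0ℤ) (pairing-congʳ-supp f (h ∘ suc))
... | inj₂ eq   = cong₂ (λ a b → c ℤ.* a ℤ.+ b) eq (pairing-congʳ-supp f (h ∘ suc))

pairing-congʳ : ∀ f {s t} → (∀ e → s e ≡ t e) → ⟪ f , s ⟫ ≡ ⟪ f , t ⟫
pairing-congʳ f h = pairing-congʳ-supp f (inj₂ ∘ h)

pairing-0ʳ : ∀ f → ⟪ f , (λ _ → + 0) ⟫ ≡ + 0
pairing-0ʳ []      = refl
pairing-0ʳ (c ∷ f) = cong₂ ℤ._+_ (ℤ.*-zeroʳ c) (pairing-0ʳ f)

pairing-zero : ∀ f {s} → (∀ e → coeff f e ≡ + 0 ⊎ s e ≡ + 0) → ⟪ f , s ⟫ ≡ + 0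
pairing-zero f h = trans (pairing-congʳ-supp f h) (pairing-0ʳ f)

pairing-congˡ : ∀ f g s → f ≈ₚ g → ⟪ f , s ⟫ ≡ ⟪ g , s ⟫
pairing-congˡ []      g       s h = sym (pairing-zero g {s} (inj₁ ∘ sym ∘ h))
pairing-congˡ (c ∷ f) []      s h = pairing-zero (c ∷ f) {s} (inj₁ ∘ h)
pairing-congˡ (c ∷ f) (d ∷ g) s h =
  cong₂ (λ a b → a ℤ.* s 0 ℤ.+ b) (h 0) (pairing-congˡ f g (s ∘ suc) (h ∘ suc))

pairing-+ˡ : ∀ f g s → ⟪ f +ₚ g , s ⟫ ≡ ⟪ f , s ⟫ ℤ.+ ⟪ g , s ⟫
pairing-+ˡ []      g       s = sym (ℤ.+-identityˡ _)
pairing-+ˡ (a ∷ f) []      s = sym (ℤ.+-identityʳ _)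
pairing-+ˡ (a ∷ f) (b ∷ g) s =
  trans (cong (ℤ._+_ ((a ℤ.+ b) ℤ.* s 0)) (pairing-+ˡ f g (s ∘ suc))) (lemma a b (s 0) _ _)
  where
  lemma : ∀ a b c x y → (a ℤ.+ b) ℤ.* c ℤ.+ (x ℤ.+ y) ≡ a ℤ.* c ℤ.+ x ℤ.+ (b ℤ.* c ℤ.+ y)
  lemma = solve-∀

pairing-scale : ∀ c f s → ⟪ scale c f , s ⟫ ≡ c ℤ.* ⟪ f , s ⟫
pairing-scale c []      s = sym (ℤ.*-zeroʳ c)
pairing-scale c (a ∷ f) s =
  trans (cong (ℤ._+_ (c ℤ.* a ℤ.* s 0)) (pairing-scale c f (s ∘ suc))) (lemma c a (s 0) _)
  where
  lemma : ∀ c a x y → c ℤ.* a ℤ.* x ℤ.+ c ℤ.* y ≡ c ℤ.* (a ℤ.* x ℤ.+ y)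
  lemma = solve-∀

pairing-neg : ∀ f s → ⟪ negₚ f , s ⟫ ≡ ℤ.- ⟪ f , s ⟫
pairing-neg []      s = refl
pairing-neg (a ∷ f) s =
  trans (cong (ℤ._+_ (ℤ.- a ℤ.* s 0)) (pairing-neg f (s ∘ suc))) (lemma a (s 0) _)
  where
  lemma : ∀ a x y → ℤ.- a ℤ.* x ℤ.+ ℤ.- y ≡ ℤ.- (a ℤ.* x ℤ.+ y)
  lemma = solve-∀

-- As x^a x^b is tested by s (a + b), a product is an iterated pairing. The laws of multiplication
-- thereby reduce to linearity, to laws of addition on ℕ, and to exchanging two finite sums.
pairing-* : ∀ f g s → ⟪ f *ₚ g , s ⟫ ≡ ⟪ f , (λ a → ⟪ g , (λ b → s (a + b)) ⟫) ⟫
pairing-* []      g s = refl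
pairing-* (c ∷ f) g s = begin
  ⟪ scale c g +ₚ (+ 0 ∷ f *ₚ g) , s ⟫
    ≡⟨ pairing-+ˡ (scale c g) _ s ⟩
  ⟪ scale c g , s ⟫ ℤ.+ (0ℤ ℤ.+ ⟪ f *ₚ g , s ∘ suc ⟫)
    ≡⟨ cong₂ ℤ._+_ (pairing-scale c g s) (trans (ℤ.+-identityˡ _) (pairing-* f g (s ∘ suc))) ⟩
  c ℤ.* ⟪ g , s ⟫ ℤ.+ ⟪ f , (λ a → ⟪ g , (λ b → s (suc a + b)) ⟫) ⟫ ∎
  where open ≡-Reasoning

pairing-linearʳ : ∀ c f s t → ⟪ f , (λ e → c ℤ.* s e ℤ.+ t e) ⟫ ≡ c ℤ.* ⟪ f , s ⟫ ℤ.+ ⟪ f , t ⟫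
pairing-linearʳ c []      s t = sym (trans (ℤ.+-identityʳ _) (ℤ.*-zeroʳ c))
pairing-linearʳ c (a ∷ f) s t =
  trans (cong (ℤ._+_ (a ℤ.* (c ℤ.* s 0 ℤ.+ t 0))) (pairing-linearʳ c f (s ∘ suc) (t ∘ suc)))
        (lemma c a (s 0) (t 0) _ _)
  where
  lemma : ∀ c a u v x y →
    a ℤ.* (c ℤ.* u ℤ.+ v) ℤ.+ (c ℤ.* x ℤ.+ y) ≡ c ℤ.* (a ℤ.* u ℤ.+ x) ℤ.+ (a ℤ.* v ℤ.+ y)
  lemma = solve-∀

pairing-swap : ∀ f g (t : ℕ → ℕ → ℤ) →
  ⟪ f , (λ a → ⟪ g , t a ⟫) ⟫ ≡ ⟪ g , (λ b → ⟪ f , (λ a → t a b) ⟫) ⟫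
pairing-swap []      g t = sym (pairing-0ʳ g)
pairing-swap (c ∷ f) g t =
  trans (cong (ℤ._+_ (c ℤ.* ⟪ g , t 0 ⟫)) (pairing-swap f g (t ∘ suc)))
        (sym (pairing-linearʳ c g (t 0) _))

-- A record, so that f and g can be inferred from a proof.
infix 4 _≋_
record _≋_ (f g : Poly) : Set where
  constructor mk≋
  field pairing≡ : ∀ s → ⟪ f , s ⟫ ≡ ⟪ g , s ⟫
open _≋_

≈ₚ⇒≋ : ∀ f g → f ≈ₚ g → f ≋ g
≈ₚ⇒≋ f g h = mk≋ λ s → pairing-congˡ f g s h

-- Defined by recursion on both arguments, so that `δ (suc k) ∘ suc` is `δ k` by computation,
-- matching the recursion of the pairing.
δ : ℕ → ℕ → ℤ
δ zero    zero    = + 1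
δ zero    (suc e) = + 0
δ (suc k) zero    = + 0
δ (suc k) (suc e) = δ k e

pairing-δ : ∀ f k → ⟪ f , δ k ⟫ ≡ coeff f k
pairing-δ []      k       = refl
pairing-δ (c ∷ f) zero    = begin
  c ℤ.* + 1 ℤ.+ ⟪ f , (λ _ → + 0) ⟫ ≡⟨ cong₂ ℤ._+_ (ℤ.*-identityʳ c) (pairing-0ʳ f) ⟩
  c ℤ.+ + 0                         ≡⟨ ℤ.+-identityʳ c ⟩
  c                                 ∎
  where open ≡-Reasoning
pairing-δ (c ∷ f) (suc k) = begin
  c ℤ.* 0ℤ ℤ.+ ⟪ f , δ k ⟫ ≡⟨ cong₂ ℤ._+_ (ℤ.*-zeroʳ c) (pairing-δ f k) ⟩
  0ℤ ℤ.+ coeff f k         ≡⟨ ℤ.+-identityˡ _ ⟩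
  coeff f k                 ∎
  where open ≡-Reasoning

≋⇒≈ₚ : ∀ {f g} → f ≋ g → f ≈ₚ g
≋⇒≈ₚ {f} {g} h k = trans (sym (pairing-δ f k)) (trans (pairing≡ h (δ k)) (pairing-δ g k))

pairing-one : ∀ s → ⟪ oneₚ , s ⟫ ≡ s 0
pairing-one s = trans (ℤ.+-identityʳ _) (ℤ.*-identityˡ (s 0))

-- The commutative ring of polynomials

*ₚ-cong : ∀ {f f′ g g′} → f ≋ f′ → g ≋ g′ → f *ₚ g ≋ f′ *ₚ g′
*ₚ-cong {f} {f′} {g} {g′} h h′ = mk≋ λ s → begin
  ⟪ f *ₚ g , s ⟫                                ≡⟨ pairing-* f g s ⟩
  ⟪ f , (λ a → ⟪ g , (λ b → s (a + b)) ⟫) ⟫     ≡⟨ pairing≡ h _ ⟩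
  ⟪ f′ , (λ a → ⟪ g , (λ b → s (a + b)) ⟫) ⟫    ≡⟨ pairing-congʳ f′ (λ a → pairing≡ h′ _) ⟩
  ⟪ f′ , (λ a → ⟪ g′ , (λ b → s (a + b)) ⟫) ⟫   ≡⟨ pairing-* f′ g′ s ⟨
  ⟪ f′ *ₚ g′ , s ⟫                              ∎
  where open ≡-Reasoning

*ₚ-comm : ∀ f g → f *ₚ g ≋ g *ₚ f
*ₚ-comm f g = mk≋ λ s → begin
  ⟪ f *ₚ g , s ⟫                              ≡⟨ pairing-* f g s ⟩
  ⟪ f , (λ a → ⟪ g , (λ b → s (a + b)) ⟫) ⟫   ≡⟨ pairing-swap f g _ ⟩
  ⟪ g , (λ b → ⟪ f , (λ a → s (a + b)) ⟫) ⟫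
    ≡⟨ pairing-congʳ g (λ b → pairing-congʳ f (λ a → cong s (ℕ.+-comm a b))) ⟩
  ⟪ g , (λ b → ⟪ f , (λ a → s (b + a)) ⟫) ⟫   ≡⟨ pairing-* g f s ⟨
  ⟪ g *ₚ f , s ⟫                              ∎
  where open ≡-Reasoning

*ₚ-assoc : ∀ f g h → (f *ₚ g) *ₚ h ≋ f *ₚ (g *ₚ h)
*ₚ-assoc f g h = mk≋ λ s → begin
  ⟪ (f *ₚ g) *ₚ h , s ⟫
    ≡⟨ trans (pairing-* (f *ₚ g) h s) (pairing-* f g _) ⟩
  ⟪ f , (λ a → ⟪ g , (λ b → ⟪ h , (λ c → s (a + b + c)) ⟫) ⟫) ⟫
    ≡⟨ pairing-congʳ f (λ a → pairing-congʳ g λ b → pairing-congʳ h λ c → cong s (ℕ.+-assoc a b c)) ⟩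
  ⟪ f , (λ a → ⟪ g , (λ b → ⟪ h , (λ c → s (a + (b + c))) ⟫) ⟫) ⟫
    ≡⟨ pairing-congʳ f (λ a → pairing-* g h _) ⟨
  ⟪ f , (λ a → ⟪ g *ₚ h , (λ b → s (a + b)) ⟫) ⟫
    ≡⟨ pairing-* f (g *ₚ h) s ⟨
  ⟪ f *ₚ (g *ₚ h) , s ⟫ ∎
  where open ≡-Reasoning

*ₚ-identityˡ : ∀ f → oneₚ *ₚ f ≋ f
*ₚ-identityˡ f = mk≋ λ s → trans (pairing-* oneₚ f s) (pairing-one (λ a → ⟪ f , (λ b → s (a + b)) ⟫))

*ₚ-distribʳ : ∀ f g h → (g +ₚ h) *ₚ f ≋ g *ₚ f +ₚ h *ₚ f
*ₚ-distribʳ f g h = mk≋ λ s → begin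
  ⟪ (g +ₚ h) *ₚ f , s ⟫                ≡⟨ trans (pairing-* (g +ₚ h) f s) (pairing-+ˡ g h _) ⟩
  _                                    ≡⟨ cong₂ ℤ._+_ (pairing-* g f s) (pairing-* h f s) ⟨
  ⟪ g *ₚ f , s ⟫ ℤ.+ ⟪ h *ₚ f , s ⟫    ≡⟨ pairing-+ˡ (g *ₚ f) (h *ₚ f) s ⟨
  ⟪ g *ₚ f +ₚ h *ₚ f , s ⟫             ∎
  where open ≡-Reasoning

+ₚ-cong : ∀ {f f′ g g′} → f ≋ f′ → g ≋ g′ → f +ₚ g ≋ f′ +ₚ g′
+ₚ-cong {f} {f′} {g} {g′} h h′ = mk≋ λ s →
  trans (pairing-+ˡ f g s) (trans (cong₂ ℤ._+_ (pairing≡ h s) (pairing≡ h′ s)) (sym (pairing-+ˡ f′ g′ s)))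

+ₚ-comm : ∀ f g → f +ₚ g ≋ g +ₚ f
+ₚ-comm f g = mk≋ λ s →
  trans (pairing-+ˡ f g s) (trans (ℤ.+-comm ⟪ f , s ⟫ _) (sym (pairing-+ˡ g f s)))

+ₚ-assoc : ∀ f g h → (f +ₚ g) +ₚ h ≋ f +ₚ (g +ₚ h)
+ₚ-assoc f g h = mk≋ λ s → begin
  ⟪ (f +ₚ g) +ₚ h , s ⟫                    ≡⟨ pairing-+ˡ (f +ₚ g) h s ⟩
  ⟪ f +ₚ g , s ⟫ ℤ.+ ⟪ h , s ⟫             ≡⟨ cong (ℤ._+ ⟪ h , s ⟫) (pairing-+ˡ f g s) ⟩
  ⟪ f , s ⟫ ℤ.+ ⟪ g , s ⟫ ℤ.+ ⟪ h , s ⟫    ≡⟨ ℤ.+-assoc ⟪ f , s ⟫ _ _ ⟩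
  ⟪ f , s ⟫ ℤ.+ (⟪ g , s ⟫ ℤ.+ ⟪ h , s ⟫)  ≡⟨ cong (ℤ._+_ ⟪ f , s ⟫) (pairing-+ˡ g h s) ⟨
  ⟪ f , s ⟫ ℤ.+ ⟪ g +ₚ h , s ⟫             ≡⟨ pairing-+ˡ f (g +ₚ h) s ⟨
  ⟪ f +ₚ (g +ₚ h) , s ⟫                    ∎
  where open ≡-Reasoning

negₚ-cong : ∀ {f g} → f ≋ g → negₚ f ≋ negₚ g
negₚ-cong {f} {g} h = mk≋ λ s →
  trans (pairing-neg f s) (trans (cong ℤ.-_ (pairing≡ h s)) (sym (pairing-neg g s)))

+ₚ-inverseʳ : ∀ f → f +ₚ negₚ f ≋ []
+ₚ-inverseʳ f = mk≋ λ s →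
  trans (pairing-+ˡ f (negₚ f) s)
        (trans (cong (ℤ._+_ ⟪ f , s ⟫) (pairing-neg f s)) (ℤ.+-inverseʳ ⟪ f , s ⟫))

≋-refl : ∀ {f} → f ≋ f
≋-refl = mk≋ λ s → refl

≋-sym : ∀ {f g} → f ≋ g → g ≋ f
≋-sym h = mk≋ λ s → sym (pairing≡ h s)

≋-trans : ∀ {f g h} → f ≋ g → g ≋ h → f ≋ h
≋-trans h h′ = mk≋ λ s → trans (pairing≡ h s) (pairing≡ h′ s)

polyRing : CommutativeRing 0ℓ 0ℓ
polyRing = record
  { Carrier = Poly ; _≈_ = _≋_ ; _+_ = _+ₚ_ ; _*_ = _*ₚ_ ; -_ = negₚ ; 0# = [] ; 1# = oneₚ
  ; isCommutativeRing = record
    { isRing = record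
      { +-isAbelianGroup = record
        { isGroup = record
          { isMonoid = record
            { isSemigroup = record
              { isMagma = record
                { isEquivalence = record { refl = ≋-refl ; sym = ≋-sym ; trans = ≋-trans }
                ; ∙-cong = +ₚ-cong }
              ; assoc = +ₚ-assoc }
            ; identity = (λ f → ≋-refl) , (λ f → ≋-trans (+ₚ-comm f []) ≋-refl) }
          ; inverse = (λ f → ≋-trans (+ₚ-comm (negₚ f) f) (+ₚ-inverseʳ f)) , +ₚ-inverseʳ
          ; ⁻¹-cong = negₚ-cong }
        ; comm = +ₚ-comm }
      ; *-cong = *ₚ-cong
      ; *-assoc = *ₚ-assoc
      ; *-identity = *ₚ-identityˡ , (λ f → ≋-trans (*ₚ-comm f oneₚ) (*ₚ-identityˡ f))
      ; distrib = (λ f g h → ≋-trans (*ₚ-comm f (g +ₚ h))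
                     (≋-trans (*ₚ-distribʳ f g h) (+ₚ-cong (*ₚ-comm g f) (*ₚ-comm h f))))
                , *ₚ-distribʳ }
    ; *-comm = *ₚ-comm } }

-- Lets the ring solver discard zero constants. Answering `nothing` is always sound, so recognising
-- lists of literal zeros is enough.
isZero? : (f : Poly) → Maybe ([] ≋ f)
isZero? []      = just ≋-refl
isZero? (+ 0 ∷ f) with isZero? f
... | just h  = just (mk≋ λ s → trans (pairing≡ h (s ∘ suc)) (sym (ℤ.+-identityˡ _)))
... | nothing = nothing
isZero? _         = nothing

polyRingACR : AlmostCommutativeRing 0ℓ 0ℓ
polyRingACR = fromCommutativeRing polyRing isZero?

open import Tactic.RingSolver.NonReflective polyRingACR using (solve; _⊜_; _⊕_; _⊗_; ⊝_; Κ)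

open CommutativeRing polyRing using (zeroʳ)

module ≋-Reasoning where
  open import Relation.Binary.Reasoning.Setoid (CommutativeRing.setoid polyRing) public

coeff-+ₚ : ∀ f g k → coeff (f +ₚ g) k ≡ coeff f k ℤ.+ coeff g k
coeff-+ₚ f g k = begin
  coeff (f +ₚ g) k            ≡⟨ pairing-δ (f +ₚ g) k ⟨
  ⟪ f +ₚ g , δ k ⟫            ≡⟨ pairing-+ˡ f g (δ k) ⟩
  ⟪ f , δ k ⟫ ℤ.+ ⟪ g , δ k ⟫ ≡⟨ cong₂ ℤ._+_ (pairing-δ f k) (pairing-δ g k) ⟩
  coeff f k ℤ.+ coeff g k     ∎
  where open ≡-Reasoning

coeff-neg : ∀ f k → coeff (negₚ f) k ≡ ℤ.- coeff f k
coeff-neg f k =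
  trans (sym (pairing-δ (negₚ f) k)) (trans (pairing-neg f (δ k)) (cong ℤ.-_ (pairing-δ f k)))

coeff-scale : ∀ c f k → coeff (scale c f) k ≡ c ℤ.* coeff f k
coeff-scale c f k =
  trans (sym (pairing-δ (scale c f) k)) (trans (pairing-scale c f (δ k)) (cong (c ℤ.*_) (pairing-δ f k)))

coeff-∷*-zero : ∀ c f g → coeff ((c ∷ f) *ₚ g) 0 ≡ c ℤ.* coeff g 0
coeff-∷*-zero c f g =
  trans (coeff-+ₚ (scale c g) _ 0) (trans (ℤ.+-identityʳ _) (coeff-scale c g 0))

coeff-∷*-suc : ∀ c f g k →
  coeff ((c ∷ f) *ₚ g) (suc k) ≡ c ℤ.* coeff g (suc k) ℤ.+ coeff (f *ₚ g) k
coeff-∷*-suc c f g k =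
  trans (coeff-+ₚ (scale c g) _ (suc k)) (cong (ℤ._+ coeff (f *ₚ g) k) (coeff-scale c g (suc k)))

coeff-beyond : ∀ f {k} → length f ≤ k → coeff f k ≡ 0ℤ
coeff-beyond []      _         = refl
coeff-beyond (c ∷ f) (s≤s f≤k) = coeff-beyond f f≤k

-- Degrees

δ-refl : ∀ k → δ k k ≡ 1ℤ
δ-refl zero    = refl
δ-refl (suc k) = δ-refl k

δ-≢ : ∀ {k j} → k ≢ j → δ k j ≡ 0ℤ
δ-≢ {zero}  {zero}  k≢j = contradiction refl k≢j
δ-≢ {zero}  {suc j} k≢j = refl
δ-≢ {suc k} {zero}  k≢j = refl
δ-≢ {suc k} {suc j} k≢j = δ-≢ (k≢j ∘ cong suc)

DegreeBelow : Poly → ℕ → Set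
DegreeBelow f d = ∀ {k} → d ≤ k → coeff f k ≡ 0ℤ

-- Since `a` may be zero, this is a degree bound together with the coefficient at the bound; `d` is
-- the degree only when `a` is nonzero.
Leads : Poly → ℕ → ℤ → Set
Leads f d a = coeff f d ≡ a × DegreeBelow f (suc d)

Monic : Poly → ℕ → Set
Monic f d = Leads f d 1ℤ

degreeBelow-resp-≋ : ∀ {f g d} → f ≋ g → DegreeBelow f d → DegreeBelow g d
degreeBelow-resp-≋ f≋g h d≤k = trans (sym (≋⇒≈ₚ f≋g _)) (h d≤k)

leads-resp-≋ : ∀ {f g d a} → f ≋ g → Leads f d a → Leads g d a
leads-resp-≋ f≋g (h , h′) = trans (sym (≋⇒≈ₚ f≋g _)) h , degreeBelow-resp-≋ f≋g h′

leads-unique : ∀ {f d e a b} → a ≢ 0ℤ → b ≢ 0ℤ → Leads f d a → Leads f e b → d ≡ e × a ≡ b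
leads-unique {d = d} {e} a≢0 b≢0 (fd , f>d) (fe , f>e) with ℕ.<-cmp d e
... | tri< d<e _ _  = contradiction (trans (sym fe) (f>d d<e)) b≢0
... | tri≈ _ refl _ = refl , trans (sym fd) fe
... | tri> _ _ e<d  = contradiction (trans (sym fd) (f>e e<d)) a≢0

1≢0 : 1ℤ ≢ 0ℤ
1≢0 ()

zero-or-leads : ∀ f → f ≋ [] ⊎ ∃₂ λ d a → a ≢ 0ℤ × Leads f d a
zero-or-leads []      = inj₁ ≋-refl
zero-or-leads (c ∷ f) with zero-or-leads f
... | inj₂ (d , a , a≢0 , fd , f>d) = inj₂ (suc d , a , a≢0 , fd , λ { (s≤s d<k) → f>d d<k })
... | inj₁ f≋[] with c ℤ.≟ 0ℤ
...   | no c≢0   = inj₂ (0 , c , c≢0 , refl , λ { (s≤s {n = k} _) → ≋⇒≈ₚ f≋[] k })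
...   | yes refl = inj₁ (≈ₚ⇒≋ (c ∷ f) [] λ { zero → refl ; (suc k) → ≋⇒≈ₚ f≋[] k })

-- From a < d and b ≤ e follows a + b < d + e. The asymmetric bounds avoid a truncated subtraction,
-- and `d` may itself be zero.
degreeBelow-* : ∀ f {g d e} → DegreeBelow f d → DegreeBelow g (suc e) → DegreeBelow (f *ₚ g) (d + e)
degreeBelow-* f {g} {d} {e} f≥d g>e {k} d+e≤k = begin
  coeff (f *ₚ g) k                                    ≡⟨ pairing-δ (f *ₚ g) k ⟨
  ⟪ f *ₚ g , δ k ⟫                                    ≡⟨ pairing-* f g (δ k) ⟩
  ⟪ f , (λ a → ⟪ g , (λ b → δ k (a + b)) ⟫) ⟫         ≡⟨ pairing-zero f vanish ⟩
  0ℤ                                                  ∎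
  where
  open ≡-Reasoning
  vanish : ∀ a → coeff f a ≡ 0ℤ ⊎ ⟪ g , (λ b → δ k (a + b)) ⟫ ≡ 0ℤ
  vanish a with d ℕ.≤? a
  ... | yes d≤a = inj₁ (f≥d d≤a)
  ... | no  d≰a = inj₂ (pairing-zero g vanish′)
    where
    vanish′ : ∀ b → coeff g b ≡ 0ℤ ⊎ δ k (a + b) ≡ 0ℤ
    vanish′ b with suc e ℕ.≤? b
    ... | yes e<b = inj₁ (g>e e<b)
    ... | no  e≮b = inj₂ (δ-≢ (ℕ.>⇒≢ (ℕ.<-≤-trans (ℕ.+-mono-<-≤ (ℕ.≰⇒> d≰a) (ℕ.≤-pred (ℕ.≰⇒> e≮b))) d+e≤k)))

leads-* : ∀ f {g d e a b} → Leads f d a → Leads g e b → Leads (f *ₚ g) (d + e) (a ℤ.* b)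
leads-* f {g} {d} {e} fl@(_ , f>d) gl@(_ , g>e) = top f d fl gl , degreeBelow-* f f>d g>e
  where
  top : ∀ f d {g e a b} → Leads f d a → Leads g e b → coeff (f *ₚ g) (d + e) ≡ a ℤ.* b
  top []      d       {g} {e} (refl , _)   _  = refl
  top (c ∷ f) zero    {g} {zero} (refl , f>0) (refl , _) = coeff-∷*-zero c f g
  top (c ∷ f) zero    {g} {suc e} (refl , f>0) (refl , g>e) = begin
    coeff ((c ∷ f) *ₚ g) (suc e)                  ≡⟨ coeff-∷*-suc c f g e ⟩
    c ℤ.* coeff g (suc e) ℤ.+ coeff (f *ₚ g) e
      ≡⟨ cong (ℤ._+_ (c ℤ.* coeff g (suc e)))
              (≋⇒≈ₚ (*ₚ-cong (≈ₚ⇒≋ f [] λ k → f>0 {suc k} (s≤s z≤n)) (≋-refl {g})) e) ⟩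
    c ℤ.* coeff g (suc e) ℤ.+ 0ℤ                  ≡⟨ ℤ.+-identityʳ _ ⟩
    c ℤ.* coeff g (suc e)                         ∎
    where open ≡-Reasoning
  top (c ∷ f) (suc d) {g} {e} {a} {b} (fd , f>d) gl@(_ , g>e) = begin
    coeff ((c ∷ f) *ₚ g) (suc (d + e))                       ≡⟨ coeff-∷*-suc c f g (d + e) ⟩
    c ℤ.* coeff g (suc (d + e)) ℤ.+ coeff (f *ₚ g) (d + e)
      ≡⟨ cong₂ (λ x y → c ℤ.* x ℤ.+ y) (g>e (s≤s (ℕ.m≤n+m e d)))
               (top f d (fd , λ d<k → f>d (s≤s d<k)) gl) ⟩
    c ℤ.* 0ℤ ℤ.+ a ℤ.* b                                     ≡⟨ cong (ℤ._+ a ℤ.* b) (ℤ.*-zeroʳ c) ⟩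
    0ℤ ℤ.+ a ℤ.* b                                           ≡⟨ ℤ.+-identityˡ _ ⟩
    a ℤ.* b                                                  ∎
    where open ≡-Reasoning

monic-* : ∀ f {g d e} → Monic f d → Monic g e → Monic (f *ₚ g) (d + e)
monic-* f = leads-* f

-- A nonzero multiple of a monic polynomial has at least its degree. The recursion starts from the
-- constant term `c`: above degree d the summand c g contributes nothing, so the tail satisfies the
-- hypothesis again and vanishes; then the coefficient at d is `c` alone.
*-monic-zero : ∀ h {g d} → Monic g d → DegreeBelow (h *ₚ g) d → h ≋ []
*-monic-zero []      g-monic             hg<d = ≋-refl
*-monic-zero (c ∷ h) {g} {d} g-monic@(gd , g>d) hg<d =
  ≈ₚ⇒≋ (c ∷ h) [] λ { zero → c≡0 d gd (hg<d ℕ.≤-refl) ; (suc k) → ≋⇒≈ₚ h≋[] k }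
  where
  h≋[] : h ≋ []
  h≋[] = *-monic-zero h g-monic λ {k} d≤k → begin
    coeff (h *ₚ g) k                                 ≡⟨ ℤ.+-identityˡ _ ⟨
    0ℤ ℤ.+ coeff (h *ₚ g) k                          ≡⟨ cong (ℤ._+ coeff (h *ₚ g) k) (ℤ.*-zeroʳ c) ⟨
    c ℤ.* 0ℤ ℤ.+ coeff (h *ₚ g) k                    ≡⟨ cong (λ x → c ℤ.* x ℤ.+ coeff (h *ₚ g) k) (g>d (s≤s d≤k)) ⟨
    c ℤ.* coeff g (suc k) ℤ.+ coeff (h *ₚ g) k       ≡⟨ coeff-∷*-suc c h g k ⟨
    coeff ((c ∷ h) *ₚ g) (suc k)                     ≡⟨ hg<d (ℕ.m≤n⇒m≤1+n d≤k) ⟩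
    0ℤ                                               ∎
    where open ≡-Reasoning
  c≡0 : ∀ d → coeff g d ≡ 1ℤ → coeff ((c ∷ h) *ₚ g) d ≡ 0ℤ → c ≡ 0ℤ
  c≡0 zero g0 eq =
    trans (sym (ℤ.*-identityʳ c)) (trans (cong (c ℤ.*_) (sym g0)) (trans (sym (coeff-∷*-zero c h g)) eq))
  c≡0 (suc d) gd eq = begin
    c                                              ≡⟨ trans (ℤ.+-identityʳ _) (ℤ.*-identityʳ c) ⟨
    c ℤ.* 1ℤ ℤ.+ 0ℤ
      ≡⟨ cong₂ (λ x y → c ℤ.* x ℤ.+ y) gd (≋⇒≈ₚ (*ₚ-cong h≋[] (≋-refl {g})) d) ⟨
    c ℤ.* coeff g (suc d) ℤ.+ coeff (h *ₚ g) d     ≡⟨ coeff-∷*-suc c h g d ⟨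
    coeff ((c ∷ h) *ₚ g) (suc d)                   ≡⟨ eq ⟩
    0ℤ                                             ∎
    where open ≡-Reasoning

degreeBelow-+ : ∀ f g {d} → DegreeBelow f d → DegreeBelow g d → DegreeBelow (f +ₚ g) d
degreeBelow-+ f g hf hg {k} d≤k = trans (coeff-+ₚ f g k) (cong₂ ℤ._+_ (hf d≤k) (hg d≤k))

degreeBelow-neg : ∀ f {d} → DegreeBelow f d → DegreeBelow (negₚ f) d
degreeBelow-neg f hf {k} d≤k = trans (coeff-neg f k) (cong ℤ.-_ (hf d≤k))

+ₚ-cancel : ∀ f r → (f +ₚ r) -ₚ f ≋ r
+ₚ-cancel = solve 2 (λ f r → ((f ⊕ r) ⊕ ⊝ f) ⊜ r) ≋-refl

division-unique : ∀ {g d q q′ r r′} → Monic g d → DegreeBelow r d → DegreeBelow r′ d →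
  g *ₚ q +ₚ r ≋ g *ₚ q′ +ₚ r′ → q ≋ q′ × r ≋ r′
division-unique {g} {d} {q} {q′} {r} {r′} g-monic r<d r′<d eq = q≋q′ , (begin
  r                                   ≈⟨ +ₚ-cancel (g *ₚ q) r ⟨
  (g *ₚ q +ₚ r) -ₚ g *ₚ q             ≈⟨ +ₚ-cong eq (negₚ-cong (*ₚ-cong (≋-refl {g}) q≋q′)) ⟩
  (g *ₚ q′ +ₚ r′) -ₚ g *ₚ q′          ≈⟨ +ₚ-cancel (g *ₚ q′) r′ ⟩
  r′                                  ∎)
  where
  open ≋-Reasoning
  difference : (q -ₚ q′) *ₚ g ≋ r′ -ₚ r
  difference = begin
    (q -ₚ q′) *ₚ g
      ≈⟨ solve 4 (λ g q q′ r → ((q ⊕ ⊝ q′) ⊗ g) ⊜ ((g ⊗ q ⊕ r) ⊕ ⊝ (g ⊗ q′) ⊕ ⊝ r)) ≋-refl g q q′ r ⟩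
    (g *ₚ q +ₚ r) -ₚ g *ₚ q′ -ₚ r
      ≈⟨ +ₚ-cong (+ₚ-cong eq ≋-refl) ≋-refl ⟩
    (g *ₚ q′ +ₚ r′) -ₚ g *ₚ q′ -ₚ r
      ≈⟨ +ₚ-cong (+ₚ-cancel (g *ₚ q′) r′) ≋-refl ⟩
    r′ -ₚ r ∎
  q-q′≋[] : q -ₚ q′ ≋ []
  q-q′≋[] = *-monic-zero (q -ₚ q′) g-monic
    (degreeBelow-resp-≋ (≋-sym difference) (degreeBelow-+ r′ (negₚ r) r′<d (degreeBelow-neg r r<d)))
  q≋q′ : q ≋ q′
  q≋q′ = begin
    q                 ≈⟨ solve 2 (λ q q′ → q ⊜ ((q ⊕ ⊝ q′) ⊕ q′)) ≋-refl q q′ ⟩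
    (q -ₚ q′) +ₚ q′   ≈⟨ +ₚ-cong q-q′≋[] ≋-refl ⟩
    q′                ∎

-- Correctness of long division

pairing-++ : ∀ f g s → ⟪ f ++ g , s ⟫ ≡ ⟪ f , s ⟫ ℤ.+ ⟪ g , (λ e → s (length f + e)) ⟫
pairing-++ []      g s = sym (ℤ.+-identityˡ _)
pairing-++ (c ∷ f) g s =
  trans (cong (ℤ._+_ (c ℤ.* s 0)) (pairing-++ f g (s ∘ suc))) (sym (ℤ.+-assoc (c ℤ.* s 0) _ _))

-- The bridge to `divH`, whose lists start with the highest degree: the head belongs to the exponent
-- given by the length of the tail.
pairing-reverse-∷ : ∀ c a s → ⟪ reverse (c ∷ a) , s ⟫ ≡ ⟪ reverse a , s ⟫ ℤ.+ c ℤ.* s (length a)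
pairing-reverse-∷ c a s = begin
  ⟪ reverse (c ∷ a) , s ⟫            ≡⟨ cong ⟪_, s ⟫ (List.unfold-reverse c a) ⟩
  ⟪ reverse a ++ c ∷ [] , s ⟫        ≡⟨ pairing-++ (reverse a) (c ∷ []) s ⟩
  ⟪ reverse a , s ⟫ ℤ.+ (c ℤ.* s (length (reverse a) + 0) ℤ.+ 0ℤ)
    ≡⟨ cong (ℤ._+_ ⟪ reverse a , s ⟫) (ℤ.+-identityʳ _) ⟩
  ⟪ reverse a , s ⟫ ℤ.+ c ℤ.* s (length (reverse a) + 0)
    ≡⟨ cong (λ n → ⟪ reverse a , s ⟫ ℤ.+ c ℤ.* s n)
            (trans (ℕ.+-identityʳ _) (List.length-reverse a)) ⟩
  ⟪ reverse a , s ⟫ ℤ.+ c ℤ.* s (length a) ∎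
  where open ≡-Reasoning

length-subPrefix : ∀ n xs ys → length ys ≡ n + length xs → length (subPrefix xs ys) ≡ length ys
length-subPrefix n []       ys       eq = refl
length-subPrefix n (x ∷ xs) []       eq = refl
length-subPrefix n (x ∷ xs) (y ∷ ys) eq =
  cong suc (length-subPrefix n xs ys (ℕ.suc-injective (trans eq (ℕ.+-suc n (length xs)))))

-- Aligning highest-first lists at their heads multiplies the shorter one by x^n, where n is the
-- difference of the lengths; on sequences this is a shift by n.
pairing-subPrefix : ∀ n xs ys s → length ys ≡ n + length xs →
  ⟪ reverse (subPrefix xs ys) , s ⟫ ≡ ⟪ reverse ys , s ⟫ ℤ.- ⟪ reverse xs , (λ e → s (n + e)) ⟫
pairing-subPrefix n []       ys       s eq = sym (ℤ.+-identityʳ _)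
pairing-subPrefix n (x ∷ xs) []       s eq = contradiction (trans eq (ℕ.+-suc n _)) λ ()
pairing-subPrefix n (x ∷ xs) (y ∷ ys) s eq = begin
  ⟪ reverse ((y ℤ.- x) ∷ subPrefix xs ys) , s ⟫
    ≡⟨ pairing-reverse-∷ (y ℤ.- x) (subPrefix xs ys) s ⟩
  ⟪ reverse (subPrefix xs ys) , s ⟫ ℤ.+ (y ℤ.- x) ℤ.* s (length (subPrefix xs ys))
    ≡⟨ cong₂ (λ a l → a ℤ.+ (y ℤ.- x) ℤ.* s l)
             (pairing-subPrefix n xs ys s eq′) (length-subPrefix n xs ys eq′) ⟩
  ⟪ reverse ys , s ⟫ ℤ.- X ℤ.+ (y ℤ.- x) ℤ.* s (length ys)
    ≡⟨ lemma ⟪ reverse ys , s ⟫ X y x (s (length ys)) ⟩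
  (⟪ reverse ys , s ⟫ ℤ.+ y ℤ.* s (length ys)) ℤ.- (X ℤ.+ x ℤ.* s (length ys))
    ≡⟨ cong (λ l → (⟪ reverse ys , s ⟫ ℤ.+ y ℤ.* s (length ys)) ℤ.- (X ℤ.+ x ℤ.* s l)) eq′ ⟩
  (⟪ reverse ys , s ⟫ ℤ.+ y ℤ.* s (length ys)) ℤ.- (X ℤ.+ x ℤ.* s (n + length xs))
    ≡⟨ cong₂ ℤ._-_ (pairing-reverse-∷ y ys s) (pairing-reverse-∷ x xs (λ e → s (n + e))) ⟨
  ⟪ reverse (y ∷ ys) , s ⟫ ℤ.- ⟪ reverse (x ∷ xs) , (λ e → s (n + e)) ⟫ ∎
  where
  open ≡-Reasoning
  eq′ = ℕ.suc-injective (trans eq (ℕ.+-suc n (length xs)))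
  X = ⟪ reverse xs , (λ e → s (n + e)) ⟫
  lemma : ∀ a b y x l → a ℤ.- b ℤ.+ (y ℤ.- x) ℤ.* l ≡ (a ℤ.+ y ℤ.* l) ℤ.- (b ℤ.+ x ℤ.* l)
  lemma = solve-∀

length-divH : ∀ n a bs → length a ≡ n + length bs → length (divH n a bs) ≡ n
length-divH zero    a       bs eq = refl
length-divH (suc n) (c ∷ a) bs eq = cong suc (length-divH n _ bs (trans
  (length-subPrefix n (map (c ℤ.*_) bs) a (trans eq′ (cong (_+_ n) (sym (List.length-map _ bs))))) eq′))
  where eq′ = ℕ.suc-injective eq

reverse-subPrefix : ∀ c n a bs s → length a ≡ n + length bs →
  ⟪ reverse (c ∷ a) , s ⟫ ≡
  ⟪ reverse (subPrefix (map (c ℤ.*_) bs) a) , s ⟫ ℤ.+ c ℤ.* ⟪ reverse (1ℤ ∷ bs) , (λ e → s (n + e)) ⟫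
reverse-subPrefix c n a bs s eq = begin
  ⟪ reverse (c ∷ a) , s ⟫
    ≡⟨ pairing-reverse-∷ c a s ⟩
  A ℤ.+ c ℤ.* s (length a)
    ≡⟨ cong (λ l → A ℤ.+ c ℤ.* s l) eq ⟩
  A ℤ.+ c ℤ.* L
    ≡⟨ lemma A B c L ⟩
  A ℤ.- c ℤ.* B ℤ.+ c ℤ.* (B ℤ.+ 1ℤ ℤ.* L)
    ≡⟨ cong (λ x → A ℤ.- x ℤ.+ c ℤ.* (B ℤ.+ 1ℤ ℤ.* L)) (begin
         ⟪ reverse (map (c ℤ.*_) bs) , shifted ⟫
           ≡⟨ cong ⟪_, shifted ⟫ (sym (List.reverse-map (c ℤ.*_) bs)) ⟩
         ⟪ map (c ℤ.*_) (reverse bs) , shifted ⟫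
           ≡⟨ pairing-scale c (reverse bs) shifted ⟩
         c ℤ.* B ∎) ⟨
  A ℤ.- ⟪ reverse (map (c ℤ.*_) bs) , shifted ⟫ ℤ.+ c ℤ.* (B ℤ.+ 1ℤ ℤ.* L)
    ≡⟨ cong₂ (λ x y → x ℤ.+ c ℤ.* y)
         (pairing-subPrefix n (map (c ℤ.*_) bs) a s
            (trans eq (cong (_+_ n) (sym (List.length-map (c ℤ.*_) bs)))))
         (pairing-reverse-∷ 1ℤ bs shifted) ⟨
  ⟪ reverse (subPrefix (map (c ℤ.*_) bs) a) , s ⟫ ℤ.+ c ℤ.* ⟪ reverse (1ℤ ∷ bs) , shifted ⟫ ∎
  where
  open ≡-Reasoning
  shifted = λ e → s (n + e)
  A = ⟪ reverse a , s ⟫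
  B = ⟪ reverse bs , shifted ⟫
  L = s (n + length bs)
  lemma : ∀ a b c l → a ℤ.+ c ℤ.* l ≡ a ℤ.- c ℤ.* b ℤ.+ c ℤ.* (b ℤ.+ 1ℤ ℤ.* l)
  lemma = solve-∀

-- One round of long division: f = f′ + c x^n g and q = q′ + c x^n, with both equations given on
-- sequences, where the factor x^n is a shift.
division-step : ∀ {f f′ g q q′ r} c n →
  (∀ s → ⟪ f , s ⟫ ≡ ⟪ f′ , s ⟫ ℤ.+ c ℤ.* ⟪ g , (λ e → s (n + e)) ⟫) →
  (∀ s → ⟪ q , s ⟫ ≡ ⟪ q′ , s ⟫ ℤ.+ c ℤ.* s n) →
  f′ ≋ g *ₚ q′ +ₚ r → f ≋ g *ₚ q +ₚ r
division-step {f} {f′} {g} {q} {q′} {r} c n hf hq f′≋ = mk≋ λ s → begin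
  ⟪ f , s ⟫
    ≡⟨ hf s ⟩
  ⟪ f′ , s ⟫ ℤ.+ X s
    ≡⟨ cong (ℤ._+ X s) (trans (pairing≡ f′≋ s) (expand q′ s)) ⟩
  ⟪ q′ , paired s ⟫ ℤ.+ ⟪ r , s ⟫ ℤ.+ X s
    ≡⟨ swap ⟪ q′ , paired s ⟫ ⟪ r , s ⟫ (X s) ⟩
  ⟪ q′ , paired s ⟫ ℤ.+ X s ℤ.+ ⟪ r , s ⟫
    ≡⟨ cong (ℤ._+ ⟪ r , s ⟫) (hq (paired s)) ⟨
  ⟪ q , paired s ⟫ ℤ.+ ⟪ r , s ⟫
    ≡⟨ expand q s ⟨
  ⟪ g *ₚ q +ₚ r , s ⟫ ∎
  where
  open ≡-Reasoning
  paired : (ℕ → ℤ) → ℕ → ℤ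
  paired s e = ⟪ g , (λ e′ → s (e + e′)) ⟫
  X : (ℕ → ℤ) → ℤ
  X s = c ℤ.* paired s n
  swap : ∀ a b c → a ℤ.+ b ℤ.+ c ≡ a ℤ.+ c ℤ.+ b
  swap = solve-∀
  expand : ∀ q s → ⟪ g *ₚ q +ₚ r , s ⟫ ≡ ⟪ q , paired s ⟫ ℤ.+ ⟪ r , s ⟫
  expand q s = trans (pairing-+ˡ (g *ₚ q) r s)
    (cong (ℤ._+ ⟪ r , s ⟫) (trans (pairing≡ (*ₚ-comm g q) s) (pairing-* q g s)))

-- The fuel equals the excess of the length of `a` over that of `bs`, so exactly `length bs`
-- coefficients are left when it runs out, and these form the remainder.
divH-correct : ∀ n a bs → length a ≡ n + length bs → ∃ λ r → length r ≡ length bs ×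
  reverse a ≋ reverse (1ℤ ∷ bs) *ₚ reverse (divH n a bs) +ₚ reverse r
divH-correct zero    a bs eq =
  a , eq , ≋-sym (+ₚ-cong {g = reverse a} (zeroʳ (reverse (1ℤ ∷ bs))) ≋-refl)
divH-correct (suc n) (c ∷ a) bs eq =
  let eq₁ = ℕ.suc-injective eq
      eq₂ = trans (length-subPrefix n (map (c ℤ.*_) bs) a
              (trans eq₁ (cong (_+_ n) (sym (List.length-map (c ℤ.*_) bs))))) eq₁
      q   = divH n (subPrefix (map (c ℤ.*_) bs) a) bs
      r , r-length , step = divH-correct n (subPrefix (map (c ℤ.*_) bs) a) bs eq₂
  in r , r-length , division-step {g = reverse (1ℤ ∷ bs)} {q = reverse (c ∷ q)} {r = reverse r} c n
       (λ s → reverse-subPrefix c n a bs s eq₁)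
       (λ s → trans (pairing-reverse-∷ c q s)
                    (cong (λ l → ⟪ reverse q , s ⟫ ℤ.+ c ℤ.* s l) (length-divH n _ bs eq₂)))
       step

reverse-dropLeadingZeros : ∀ xs → reverse (dropLeadingZeros xs) ≋ reverse xs
reverse-dropLeadingZeros []                 = ≋-refl
reverse-dropLeadingZeros (+ zero ∷ xs)      = ≋-trans (reverse-dropLeadingZeros xs)
  (mk≋ λ s → sym (trans (pairing-reverse-∷ 0ℤ xs s) (ℤ.+-identityʳ _)))
reverse-dropLeadingZeros (+ suc _ ∷ xs)     = ≋-refl
reverse-dropLeadingZeros (ℤ.-[1+_] _ ∷ xs)  = ≋-refl

dropLeadingZeros-head : ∀ xs →
  dropLeadingZeros xs ≡ [] ⊎ ∃₂ λ c ys → dropLeadingZeros xs ≡ c ∷ ys × c ≢ 0ℤ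
dropLeadingZeros-head []                = inj₁ refl
dropLeadingZeros-head (+ zero ∷ xs)     = dropLeadingZeros-head xs
dropLeadingZeros-head (+ suc _ ∷ xs)    = inj₂ (_ , xs , refl , λ ())
dropLeadingZeros-head (ℤ.-[1+_] _ ∷ xs) = inj₂ (_ , xs , refl , λ ())

reverse-∷-leads : ∀ c bs → Leads (reverse (c ∷ bs)) (length bs) c
reverse-∷-leads c bs = top , λ {k} l<k → coeff-beyond (reverse (c ∷ bs))
                              (subst (_≤ k) (sym (List.length-reverse (c ∷ bs))) l<k)
  where
  open ≡-Reasoning
  top : coeff (reverse (c ∷ bs)) (length bs) ≡ c
  top = begin
    coeff (reverse (c ∷ bs)) (length bs)       ≡⟨ pairing-δ (reverse (c ∷ bs)) _ ⟨
    ⟪ reverse (c ∷ bs) , δ (length bs) ⟫       ≡⟨ pairing-reverse-∷ c bs _ ⟩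
    ⟪ reverse bs , δ (length bs) ⟫ ℤ.+ c ℤ.* δ (length bs) (length bs)
      ≡⟨ cong₂ (λ x y → x ℤ.+ c ℤ.* y) (trans (pairing-δ (reverse bs) _)
                 (coeff-beyond (reverse bs) (ℕ.≤-reflexive (List.length-reverse bs))))
               (δ-refl (length bs)) ⟩
    0ℤ ℤ.+ c ℤ.* 1ℤ                            ≡⟨ trans (ℤ.+-identityˡ _) (ℤ.*-identityʳ c) ⟩
    c                                          ∎

-- `quotₚ` drops the head of the reversed trimmed divisor as though it were 1. Trimming makes that
-- head the leading coefficient, so for a monic divisor it is 1, and the rest has the degree as its
-- length.
trim-monic : ∀ g {d} → Monic g d →
  ∃ λ bs → reverse (trim g) ≡ 1ℤ ∷ bs × length bs ≡ d × g ≋ reverse (1ℤ ∷ bs)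
trim-monic g {d} g-monic =
  conclude (subst (λ xs → xs ≡ [] ⊎ ∃₂ λ c ys → xs ≡ c ∷ ys × c ≢ 0ℤ) (sym rev-trim)
                  (dropLeadingZeros-head (reverse g)))
  where
  rev-trim : reverse (trim g) ≡ dropLeadingZeros (reverse g)
  rev-trim = List.reverse-involutive _
  g≋ : g ≋ reverse (reverse (trim g))
  g≋ = subst₂ (λ x y → x ≋ reverse y) (List.reverse-involutive g) (sym rev-trim)
              (≋-sym (reverse-dropLeadingZeros (reverse g)))
  conclude : reverse (trim g) ≡ [] ⊎ (∃₂ λ c ys → reverse (trim g) ≡ c ∷ ys × c ≢ 0ℤ) →
    ∃ λ bs → reverse (trim g) ≡ 1ℤ ∷ bs × length bs ≡ d × g ≋ reverse (1ℤ ∷ bs)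
  conclude (inj₁ eq) =
    contradiction (trans (sym (proj₁ g-monic)) (≋⇒≈ₚ (subst (λ x → g ≋ reverse x) eq g≋) d)) 1≢0
  conclude (inj₂ (c , bs , eq , c≢0))
    with refl , refl ← leads-unique {reverse (c ∷ bs)} c≢0 1≢0 (reverse-∷-leads c bs)
                         (leads-resp-≋ (subst (λ x → g ≋ reverse x) eq g≋) g-monic)
    = bs , eq , refl , subst (λ x → g ≋ reverse x) eq g≋

quotₚ-unfold : ∀ f g {c bs} → reverse (trim g) ≡ c ∷ bs →
  quotₚ f g ≡ reverse (divH (length f ∸ length bs) (reverse f) bs)
quotₚ-unfold f g eq rewrite eq = refl

division : ∀ f g {d} → Monic g d → ∃ λ r → DegreeBelow r d × f ≋ g *ₚ quotₚ f g +ₚ r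
division f g g-monic with bs , eq , refl , g≋ ← trim-monic g g-monic
  with ℕ.≤-total (length bs) (length f)
-- For a short dividend the truncated subtraction gives fuel zero: the quotient is empty and `f` is
-- its own remainder.
... | inj₂ f≤bs = f , (λ bs≤k → coeff-beyond f (ℕ.≤-trans f≤bs bs≤k)) ,
  subst (λ q → f ≋ g *ₚ q +ₚ f)
        (sym (trans (quotₚ-unfold f g eq)
                    (cong (λ n → reverse (divH n (reverse f) bs)) (ℕ.m≤n⇒m∸n≡0 f≤bs))))
        (≋-sym (+ₚ-cong {g = f} (zeroʳ g) ≋-refl))
... | inj₁ bs≤f
  with r , r-length , h ← divH-correct (length f ∸ length bs) (reverse f) bs
                            (trans (List.length-reverse f) (sym (ℕ.m∸n+n≡m bs≤f)))
  = reverse r , (λ bs≤k → coeff-beyond (reverse r) (ℕ.≤-trans (ℕ.≤-reflexive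
                             (trans (List.length-reverse r) r-length)) bs≤k))
  , subst₂ (λ x q → x ≋ g *ₚ q +ₚ reverse r) (List.reverse-involutive f) (sym (quotₚ-unfold f g eq))
           (≋-trans h (+ₚ-cong (*ₚ-cong (≋-sym g≋) ≋-refl) ≋-refl))

quotₚ-remₚ-unique : ∀ {f g d q r} → Monic g d → DegreeBelow r d → f ≋ g *ₚ q +ₚ r →
  quotₚ f g ≋ q × remₚ f g ≋ r
quotₚ-remₚ-unique {f} {g} {d} {q} {r} g-monic r<d f≋ =
  let r′ , r′<d , f≋′ = division f g g-monic
      q≋ , r≋ = division-unique {g} {d} {quotₚ f g} {q} {r′} {r} g-monic r′<d r<d (≋-trans (≋-sym f≋′) f≋)
  in q≋ , (begin
    f -ₚ g *ₚ quotₚ f g                      ≈⟨ +ₚ-cong f≋′ ≋-refl ⟩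
    g *ₚ quotₚ f g +ₚ r′ -ₚ g *ₚ quotₚ f g   ≈⟨ +ₚ-cancel (g *ₚ quotₚ f g) r′ ⟩
    r′                                       ≈⟨ r≋ ⟩
    r                                        ∎)
  where open ≋-Reasoning

remₚ-degree : ∀ f g {d} → Monic g d → DegreeBelow (remₚ f g) d
remₚ-degree f g g-monic = let r , r<d , f≋ = division f g g-monic in
  degreeBelow-resp-≋ (≋-sym (proj₂ (quotₚ-remₚ-unique {f} {g} {r = r} g-monic r<d f≋))) r<d

quotₚ-exact : ∀ {f g d q} → Monic g d → f ≋ g *ₚ q → quotₚ f g ≋ q
quotₚ-exact {f} {g} {d} {q} g-monic f≋ =
  proj₁ (quotₚ-remₚ-unique {f} {g} {d} {q} {[]} g-monic (λ _ → refl) (≋-trans f≋ (≋-sym (+-identityʳ (g *ₚ q)))))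
  where open CommutativeRing polyRing using (+-identityʳ)

-- Divisibility and cancellation for monic polynomials

open import Algebra.Properties.Monoid.Divisibility (CommutativeRing.*-monoid polyRing)
  using () renaming (_∣ʳ_ to _∣ₚ_; _,_ to _,ₚ_; ∣ʳ-refl to ∣ₚ-refl; ∣ʳ-trans to ∣ₚ-trans; ε∣ʳ_ to one∣ₚ_)

*-monic-cancelʳ : ∀ {f g h d} → Monic h d → f *ₚ h ≋ g *ₚ h → f ≋ g
*-monic-cancelʳ {f} {g} {h} {d} h-monic eq = begin
  f               ≈⟨ solve 2 (λ f g → f ⊜ (g ⊕ (f ⊕ ⊝ g))) ≋-refl f g ⟩
  g +ₚ (f -ₚ g)   ≈⟨ +ₚ-cong ≋-refl (*-monic-zero (f -ₚ g) h-monic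
                       (degreeBelow-resp-≋ {[]} {(f -ₚ g) *ₚ h} {d} (≋-sym difference) (λ _ → refl))) ⟩
  g +ₚ []         ≈⟨ solve 1 (λ g → (g ⊕ Κ []) ⊜ g) ≋-refl g ⟩
  g               ∎
  where
  open ≋-Reasoning
  difference : (f -ₚ g) *ₚ h ≋ []
  difference = begin
    (f -ₚ g) *ₚ h        ≈⟨ solve 3 (λ f g h → ((f ⊕ ⊝ g) ⊗ h) ⊜ (f ⊗ h ⊕ ⊝ (g ⊗ h))) ≋-refl f g h ⟩
    f *ₚ h -ₚ g *ₚ h     ≈⟨ +ₚ-cong eq ≋-refl ⟩
    g *ₚ h -ₚ g *ₚ h     ≈⟨ +ₚ-inverseʳ (g *ₚ h) ⟩
    []                   ∎

-- The zero polynomial has no monic multiple, and otherwise leading coefficients multiply and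
-- degrees add. This is the source of every degree of a cyclotomic polynomial below.
monic-cofactor : ∀ f {g d n} → Monic g d → Monic (f *ₚ g) n → ∃ λ e → Monic f e × e + d ≡ n
monic-cofactor f {g} {d} {n} g-monic fg-monic with zero-or-leads f
... | inj₁ f≋[] =
  contradiction (trans (sym (proj₁ fg-monic)) (≋⇒≈ₚ (*ₚ-cong f≋[] (≋-refl {g})) n)) 1≢0
... | inj₂ (e , a , a≢0 , f-leads)
  with leads-unique {f *ₚ g} (a≢0 ∘ trans (sym (ℤ.*-identityʳ a))) 1≢0 (leads-* f f-leads g-monic) fg-monic
... | e+d≡n , a*1≡1 with refl ← trans (sym (ℤ.*-identityʳ a)) a*1≡1 = e , f-leads , e+d≡n

-- The polynomials x^n - 1 and comaximality up to an integer

pairing-xpow : ∀ n s → ⟪ xpow n , s ⟫ ≡ s n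
pairing-xpow zero    s = pairing-one s
pairing-xpow (suc n) s = trans (ℤ.+-identityˡ _) (pairing-xpow n (s ∘ suc))

xpow-+ : ∀ a b → xpow (a + b) ≋ xpow a *ₚ xpow b
xpow-+ a b = mk≋ λ s → begin
  ⟪ xpow (a + b) , s ⟫                                ≡⟨ pairing-xpow (a + b) s ⟩
  s (a + b)                                           ≡⟨ pairing-xpow b (λ e → s (a + e)) ⟨
  ⟪ xpow b , (λ e → s (a + e)) ⟫                      ≡⟨ pairing-xpow a (λ e → ⟪ xpow b , (λ e′ → s (e + e′)) ⟫) ⟨
  ⟪ xpow a , (λ e → ⟪ xpow b , (λ e′ → s (e + e′)) ⟫) ⟫ ≡⟨ pairing-* (xpow a) (xpow b) s ⟨
  ⟪ xpow a *ₚ xpow b , s ⟫                            ∎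
  where open ≡-Reasoning

pairing-xpowMinus1 : ∀ n s → ⟪ xpowMinus1 n , s ⟫ ≡ s n ℤ.- s 0
pairing-xpowMinus1 n s = trans (pairing-+ˡ (xpow n) (negₚ oneₚ) s)
  (cong₂ ℤ._+_ (pairing-xpow n s) (trans (pairing-neg oneₚ s) (cong ℤ.-_ (pairing-one s))))

monic-xpow : ∀ n → Monic (xpow n) n
monic-xpow n = trans (coeff-xpow n) (δ-refl n) ,
  λ {k} n<k → trans (coeff-xpow k) (δ-≢ (ℕ.>⇒≢ n<k))
  where
  coeff-xpow : ∀ k → coeff (xpow n) k ≡ δ k n
  coeff-xpow k = trans (sym (pairing-δ (xpow n) k)) (pairing-xpow n (δ k))

monic-xpowMinus1 : ∀ {n} → 0 < n → Monic (xpowMinus1 n) n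
monic-xpowMinus1 {n} 0<n =
  trans (coeff-xpowMinus1 n) (cong₂ ℤ._-_ (δ-refl n) (δ-≢ (ℕ.>⇒≢ 0<n))) ,
  λ {k} n<k → trans (coeff-xpowMinus1 k) (cong₂ ℤ._-_ (δ-≢ (ℕ.>⇒≢ n<k)) (δ-≢ (ℕ.>⇒≢ (ℕ.≤-trans (s≤s z≤n) n<k))))
  where
  coeff-xpowMinus1 : ∀ k → coeff (xpowMinus1 n) k ≡ δ k n ℤ.- δ k 0
  coeff-xpowMinus1 k = trans (sym (pairing-δ (xpowMinus1 n) k)) (pairing-xpowMinus1 n (δ k))

-- `S` is 1 + y + ⋯ + y^(k-1) for y = x^d. Each power of y is 1 modulo y - 1, so `S` reduces to the
-- integer k, with quotient `T`.
geometric : ∀ k d → ∃₂ λ S T →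
  xpowMinus1 (k * d) ≋ S *ₚ xpowMinus1 d × S ≋ constₚ (+ k) +ₚ T *ₚ xpowMinus1 d
geometric zero    d = [] , [] , ≈ₚ⇒≋ (xpowMinus1 0) [] (λ { zero → refl ; (suc _) → refl }) ,
                      ≈ₚ⇒≋ [] (constₚ (+ 0)) (λ { zero → refl ; (suc _) → refl })
geometric (suc k) d with S , T , IH₁ , IH₂ ← geometric k d =
  -- `S` gains the term Y = x^(k d), and Y = 1 + S (x^d - 1), so the integer grows by 1 and the
  -- quotient by `S`.
  S +ₚ Y , T +ₚ S , (begin
    xpow (d + k * d) -ₚ oneₚ
      ≈⟨ +ₚ-cong (xpow-+ d (k * d)) ≋-refl ⟩
    y *ₚ Y -ₚ oneₚ
      ≈⟨ solve 2 (λ y Y → (y ⊗ Y ⊕ ⊝ (Κ oneₚ)) ⊜ ((Y ⊕ ⊝ (Κ oneₚ)) ⊕ Y ⊗ (y ⊕ ⊝ (Κ oneₚ)))) ≋-refl y Y ⟩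
    (Y -ₚ oneₚ) +ₚ Y *ₚ (y -ₚ oneₚ)
      ≈⟨ +ₚ-cong IH₁ ≋-refl ⟩
    S *ₚ (y -ₚ oneₚ) +ₚ Y *ₚ (y -ₚ oneₚ)
      ≈⟨ *ₚ-distribʳ (y -ₚ oneₚ) S Y ⟨
    (S +ₚ Y) *ₚ (y -ₚ oneₚ) ∎) , (begin
    S +ₚ Y
      ≈⟨ solve 2 (λ S Y → (S ⊕ Y) ⊜ (Κ oneₚ ⊕ S ⊕ (Y ⊕ ⊝ Κ oneₚ))) ≋-refl S Y ⟩
    oneₚ +ₚ S +ₚ (Y -ₚ oneₚ)
      ≈⟨ +ₚ-cong (+ₚ-cong {oneₚ} ≋-refl IH₂) IH₁ ⟩
    oneₚ +ₚ (constₚ (+ k) +ₚ T *ₚ xpowMinus1 d) +ₚ S *ₚ xpowMinus1 d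
      ≈⟨ solve 5 (λ o K T S x → (o ⊕ (K ⊕ T ⊗ x) ⊕ S ⊗ x) ⊜ (o ⊕ K ⊕ (T ⊕ S) ⊗ x)) ≋-refl
           oneₚ (constₚ (+ k)) T S (xpowMinus1 d) ⟩
    constₚ (+ suc k) +ₚ (T +ₚ S) *ₚ xpowMinus1 d ∎)
  where
  open ≋-Reasoning
  y = xpow d
  Y = xpow (k * d)

xpowMinus1-∣ : ∀ {m n} → m ∣ n → xpowMinus1 m ∣ₚ xpowMinus1 n
xpowMinus1-∣ {m} (divides k refl) = let S , _ , h , _ = geometric k m in S ,ₚ ≋-sym h

-- With X for the indeterminate, (X^(x a) - 1) - X^d (X^(y b) - 1) = X^d - 1, and the two brackets
-- are multiples of X^a - 1 and X^b - 1. Bézout over ℕ puts the subtracted term on either side,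
-- whence the two cases of `xpowMinus1-gcd`.
bézout-combination : ∀ {d a b} x y → d + y * b ≡ x * a →
  ∃₂ λ u v → u *ₚ xpowMinus1 a +ₚ v *ₚ xpowMinus1 b ≋ xpowMinus1 d
bézout-combination {d} {a} {b} x y eq =
  let S , _ , xa≋ , _ = geometric x a
      R , _ , yb≋ , _ = geometric y b
      z = xpow d
      xpow-split : xpow (x * a) ≋ z *ₚ xpow (y * b)
      xpow-split = subst (λ n → xpow n ≋ z *ₚ xpow (y * b)) eq (xpow-+ d (y * b))
  in S , negₚ (z *ₚ R) , (begin
    S *ₚ xpowMinus1 a +ₚ negₚ (z *ₚ R) *ₚ xpowMinus1 b
      ≈⟨ solve 4 (λ p z R B → (p ⊕ (⊝ (z ⊗ R)) ⊗ B) ⊜ (p ⊕ ⊝ (z ⊗ (R ⊗ B)))) ≋-refl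
           (S *ₚ xpowMinus1 a) z R (xpowMinus1 b) ⟩
    S *ₚ xpowMinus1 a -ₚ z *ₚ (R *ₚ xpowMinus1 b)
      ≈⟨ +ₚ-cong xa≋ (negₚ-cong (*ₚ-cong (≋-refl {z}) yb≋)) ⟨
    xpowMinus1 (x * a) -ₚ z *ₚ xpowMinus1 (y * b)
      ≈⟨ +ₚ-cong (+ₚ-cong xpow-split ≋-refl) ≋-refl ⟩
    z *ₚ xpow (y * b) -ₚ oneₚ -ₚ z *ₚ xpowMinus1 (y * b)
      ≈⟨ solve 3 (λ o z Y → (z ⊗ Y ⊕ ⊝ Κ oneₚ ⊕ ⊝ (z ⊗ (Y ⊕ ⊝ Κ oneₚ))) ⊜ (z ⊕ ⊝ Κ oneₚ))
           ≋-refl oneₚ z (xpow (y * b)) ⟩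
    xpowMinus1 d ∎)
  where open ≋-Reasoning

xpowMinus1-gcd : ∀ a b → ∃₂ λ u v → u *ₚ xpowMinus1 a +ₚ v *ₚ xpowMinus1 b ≋ xpowMinus1 (gcd a b)
xpowMinus1-gcd a b with Bézout.identity (gcd-GCD a b)
... | Bézout.+- x y eq = bézout-combination x y eq
... | Bézout.-+ x y eq =
  let u , v , h = bézout-combination y x eq
  in v , u , ≋-trans (+ₚ-comm (v *ₚ xpowMinus1 a) (u *ₚ xpowMinus1 b)) h

-- Coprimality over ℚ, with the denominators cleared.
IntComaximal : Poly → Poly → Set
IntComaximal f g = ∃₂ λ u v → ∃ λ c → c ≢ 0ℤ × u *ₚ f +ₚ v *ₚ g ≋ constₚ c

constₚ-* : ∀ a b → constₚ a *ₚ constₚ b ≋ constₚ (a ℤ.* b)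
constₚ-* a b = ≈ₚ⇒≋ (constₚ a *ₚ constₚ b) (constₚ (a ℤ.* b))
  λ { zero → ℤ.+-identityʳ (a ℤ.* b) ; (suc zero) → refl ; (suc (suc _)) → refl }

*-nonzero : ∀ {a b} → a ≢ 0ℤ → b ≢ 0ℤ → a ℤ.* b ≢ 0ℤ
*-nonzero {a} a≢0 b≢0 = [ a≢0 , b≢0 ]′ ∘ ℤ.i*j≡0⇒i≡0∨j≡0 a

intComaximal-sym : ∀ {f g} → IntComaximal f g → IntComaximal g f
intComaximal-sym {f} {g} (u , v , c , c≢0 , h) =
  v , u , c , c≢0 , ≋-trans (+ₚ-comm (v *ₚ g) (u *ₚ f)) h

intComaximal-oneʳ : ∀ f → IntComaximal f oneₚ
intComaximal-oneʳ f = [] , oneₚ , 1ℤ , 1≢0 , *ₚ-identityˡ oneₚ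

-- Multiply the two Bézout identities: every term of the product contains `f` except v v′ g h.
intComaximal-*ʳ : ∀ {f g h} → IntComaximal f g → IntComaximal f h → IntComaximal f (g *ₚ h)
intComaximal-*ʳ {f} {g} {h} (u , v , c , c≢0 , eq) (u′ , v′ , c′ , c′≢0 , eq′) =
  u *ₚ (u′ *ₚ f +ₚ v′ *ₚ h) +ₚ v *ₚ g *ₚ u′ , v *ₚ v′ , c ℤ.* c′ , *-nonzero c≢0 c′≢0 , (begin
    (u *ₚ (u′ *ₚ f +ₚ v′ *ₚ h) +ₚ v *ₚ g *ₚ u′) *ₚ f +ₚ v *ₚ v′ *ₚ (g *ₚ h)
      ≈⟨ solve 7 (λ f g h u v u′ v′ →
             ((u ⊗ (u′ ⊗ f ⊕ v′ ⊗ h) ⊕ v ⊗ g ⊗ u′) ⊗ f ⊕ v ⊗ v′ ⊗ (g ⊗ h))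
             ⊜ ((u ⊗ f ⊕ v ⊗ g) ⊗ (u′ ⊗ f ⊕ v′ ⊗ h))) ≋-refl f g h u v u′ v′ ⟩
    (u *ₚ f +ₚ v *ₚ g) *ₚ (u′ *ₚ f +ₚ v′ *ₚ h)
      ≈⟨ *ₚ-cong eq eq′ ⟩
    constₚ c *ₚ constₚ c′
      ≈⟨ constₚ-* c c′ ⟩
    constₚ (c ℤ.* c′) ∎)
  where open ≋-Reasoning

constₚ-*-zero : ∀ {c f} → c ≢ 0ℤ → constₚ c *ₚ f ≋ [] → f ≋ []
constₚ-*-zero {c} {f} c≢0 h = ≈ₚ⇒≋ f [] λ k →
  [ (λ c≡0 → contradiction c≡0 c≢0) , id ]′ (ℤ.i*j≡0⇒i≡0∨j≡0 c (begin
    c ℤ.* coeff f k                    ≡⟨ coeff-scale c f k ⟨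
    coeff (scale c f) k                ≡⟨ ℤ.+-identityʳ _ ⟨
    coeff (scale c f) k ℤ.+ 0ℤ         ≡⟨ cong (ℤ._+_ (coeff (scale c f) k)) (coeff-0∷[] k) ⟨
    coeff (scale c f) k ℤ.+ coeff (0ℤ ∷ []) k ≡⟨ coeff-+ₚ (scale c f) (0ℤ ∷ []) k ⟨
    coeff (constₚ c *ₚ f) k            ≡⟨ ≋⇒≈ₚ h k ⟩
    0ℤ                                 ∎))
  where
  open ≡-Reasoning
  coeff-0∷[] : ∀ k → coeff (0ℤ ∷ []) k ≡ 0ℤ
  coeff-0∷[] zero    = refl
  coeff-0∷[] (suc k) = refl

degreeBelow-constₚ-* : ∀ c f {d} → DegreeBelow f d → DegreeBelow (constₚ c *ₚ f) d
degreeBelow-constₚ-* c f {d} f<d {k} d≤k = begin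
  coeff (constₚ c *ₚ f) k       ≡⟨ pairing-δ (constₚ c *ₚ f) k ⟨
  ⟪ constₚ c *ₚ f , δ k ⟫       ≡⟨ trans (pairing≡ (*ₚ-comm (constₚ c) f) (δ k)) (pairing-* f (constₚ c) (δ k)) ⟩
  ⟪ f , (λ e → ⟪ constₚ c , (λ e′ → δ k (e + e′)) ⟫) ⟫ ≡⟨ pairing-zero f vanish ⟩
  0ℤ ∎
  where
  open ≡-Reasoning
  vanish : ∀ e → coeff f e ≡ 0ℤ ⊎ ⟪ constₚ c , (λ e′ → δ k (e + e′)) ⟫ ≡ 0ℤ
  vanish e with d ℕ.≤? e
  ... | yes d≤e = inj₁ (f<d d≤e)
  ... | no  d≰e = inj₂ (trans (ℤ.+-identityʳ _) (trans
    (cong (c ℤ.*_) (δ-≢ (ℕ.>⇒≢ (subst (_< k) (sym (ℕ.+-identityʳ e)) (ℕ.<-≤-trans (ℕ.≰⇒> d≰e) d≤k)))))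
    (ℤ.*-zeroʳ c)))

-- If f leaves remainder r on division by `g`, then c f leaves c r. By uniqueness of division c r is
-- zero, and ℤ has no zero divisors.
∣ₚ-cancel-constₚ : ∀ {f g d c} → Monic g d → c ≢ 0ℤ → g ∣ₚ constₚ c *ₚ f → g ∣ₚ f
∣ₚ-cancel-constₚ {f} {g} {d} {c} g-monic c≢0 (q ,ₚ qg≋cf) =
  let r , r<d , f≋ = division f g g-monic
      K = constₚ c; p = quotₚ f g
      eq : g *ₚ (K *ₚ p) +ₚ K *ₚ r ≋ g *ₚ q +ₚ []
      eq = begin
        g *ₚ (K *ₚ p) +ₚ K *ₚ r
          ≈⟨ rearrange g K p r ⟩
        K *ₚ (g *ₚ p +ₚ r)
          ≈⟨ *ₚ-cong (≋-refl {K}) f≋ ⟨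
        K *ₚ f
          ≈⟨ qg≋cf ⟨
        q *ₚ g
          ≈⟨ commute q g ⟩
        g *ₚ q +ₚ [] ∎
      r≋[] = constₚ-*-zero c≢0 (proj₂
        (division-unique {g} {d} {K *ₚ p} {q} {K *ₚ r} {[]} g-monic
                         (degreeBelow-constₚ-* c r r<d) (λ _ → refl) eq))
  in p ,ₚ (begin
    p *ₚ g          ≈⟨ commute p g ⟩
    g *ₚ p +ₚ []    ≈⟨ +ₚ-cong ≋-refl r≋[] ⟨
    g *ₚ p +ₚ r     ≈⟨ f≋ ⟨
    f               ∎)
  where
  open ≋-Reasoning
  rearrange : ∀ g K p r → g *ₚ (K *ₚ p) +ₚ K *ₚ r ≋ K *ₚ (g *ₚ p +ₚ r)
  rearrange = solve 4 (λ g K p r → (g ⊗ (K ⊗ p) ⊕ K ⊗ r) ⊜ (K ⊗ (g ⊗ p ⊕ r))) ≋-refl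
  commute : ∀ p g → p *ₚ g ≋ g *ₚ p +ₚ []
  commute = solve 2 (λ p g → (p ⊗ g) ⊜ (g ⊗ p ⊕ Κ [])) ≋-refl

-- In c F = u f F + v g F, replace F by q′ g in the first term and by q f in the second: f g divides
-- c F, and c cancels because f g is monic.
∣ₚ-*-intComaximal : ∀ {f g F d} → Monic (f *ₚ g) d → IntComaximal f g → f ∣ₚ F → g ∣ₚ F → f *ₚ g ∣ₚ F
∣ₚ-*-intComaximal {f} {g} {F} fg-monic (u , v , c , c≢0 , eq) (q ,ₚ qf≋F) (q′ ,ₚ q′g≋F) =
  ∣ₚ-cancel-constₚ fg-monic c≢0 ((u *ₚ q′ +ₚ v *ₚ q) ,ₚ (begin
    (u *ₚ q′ +ₚ v *ₚ q) *ₚ (f *ₚ g)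
      ≈⟨ solve 6 (λ f g u v q q′ → ((u ⊗ q′ ⊕ v ⊗ q) ⊗ (f ⊗ g)) ⊜ (u ⊗ f ⊗ (q′ ⊗ g) ⊕ v ⊗ g ⊗ (q ⊗ f)))
           ≋-refl f g u v q q′ ⟩
    u *ₚ f *ₚ (q′ *ₚ g) +ₚ v *ₚ g *ₚ (q *ₚ f)
      ≈⟨ +ₚ-cong (*ₚ-cong (≋-refl {u *ₚ f}) q′g≋F) (*ₚ-cong (≋-refl {v *ₚ g}) qf≋F) ⟩
    u *ₚ f *ₚ F +ₚ v *ₚ g *ₚ F
      ≈⟨ *ₚ-distribʳ F (u *ₚ f) (v *ₚ g) ⟨
    (u *ₚ f +ₚ v *ₚ g) *ₚ F
      ≈⟨ *ₚ-cong eq ≋-refl ⟩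
    constₚ c *ₚ F ∎))
  where open ≋-Reasoning

IsMonic : Poly → Set
IsMonic f = ∃ (Monic f)

prodₚ-monic : ∀ {fs} → All IsMonic fs → IsMonic (prodₚ fs)
prodₚ-monic []                                = 0 , refl , λ { (s≤s _) → refl }
prodₚ-monic {f ∷ fs} ((d , f-monic) ∷ monics) =
  let e , h = prodₚ-monic monics in d + e , monic-* f f-monic h

intComaximal-prodₚ : ∀ {f gs} → All (IntComaximal f) gs → IntComaximal f (prodₚ gs)
intComaximal-prodₚ {f} []       = intComaximal-oneʳ f
intComaximal-prodₚ {f} (h ∷ hs) = intComaximal-*ʳ h (intComaximal-prodₚ hs)

prodₚ-∣ₚ : ∀ {fs F} → All IsMonic fs → AllPairs IntComaximal fs → All (_∣ₚ F) fs → prodₚ fs ∣ₚ F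
prodₚ-∣ₚ []             []                   []             = one∣ₚ _
prodₚ-∣ₚ ms@(_ ∷ monics) (comaximal ∷ pairs) (f∣F ∷ fs∣F) =
  ∣ₚ-*-intComaximal (proj₂ (prodₚ-monic ms)) (intComaximal-prodₚ comaximal) f∣F
                    (prodₚ-∣ₚ monics pairs fs∣F)

-- Substituting a power of x

pairing-composeₚ-xpow : ∀ f p s → ⟪ composeₚ f (xpow p) , s ⟫ ≡ ⟪ f , (λ e → s (e * p)) ⟫
pairing-composeₚ-xpow []      p s = refl
pairing-composeₚ-xpow (c ∷ f) p s = begin
  ⟪ constₚ c +ₚ xpow p *ₚ g , s ⟫              ≡⟨ pairing-+ˡ (constₚ c) (xpow p *ₚ g) s ⟩
  ⟪ constₚ c , s ⟫ ℤ.+ ⟪ xpow p *ₚ g , s ⟫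
    ≡⟨ cong₂ ℤ._+_ (ℤ.+-identityʳ (c ℤ.* s 0)) (trans (pairing-* (xpow p) g s)
         (trans (pairing-xpow p (λ e → ⟪ g , (λ e′ → s (e + e′)) ⟫)) (pairing-composeₚ-xpow f p _))) ⟩
  c ℤ.* s 0 ℤ.+ ⟪ f , (λ e → s (p + e * p)) ⟫  ∎
  where
  open ≡-Reasoning
  g = composeₚ f (xpow p)

composeₚ-cong : ∀ {f g} p → f ≋ g → composeₚ f (xpow p) ≋ composeₚ g (xpow p)
composeₚ-cong {f} {g} p h = mk≋ λ s →
  trans (pairing-composeₚ-xpow f p s) (trans (pairing≡ h _) (sym (pairing-composeₚ-xpow g p s)))

composeₚ-* : ∀ f g p → composeₚ (f *ₚ g) (xpow p) ≋ composeₚ f (xpow p) *ₚ composeₚ g (xpow p)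
composeₚ-* f g p = mk≋ λ s → begin
  ⟪ composeₚ (f *ₚ g) (xpow p) , s ⟫
    ≡⟨ trans (pairing-composeₚ-xpow (f *ₚ g) p s) (pairing-* f g (λ e → s (e * p))) ⟩
  ⟪ f , (λ a → ⟪ g , (λ b → s ((a + b) * p)) ⟫) ⟫
    ≡⟨ pairing-congʳ f (λ a → trans (pairing-congʳ g (λ b → cong s (ℕ.*-distribʳ-+ p a b)))
                                    (sym (pairing-composeₚ-xpow g p (λ e → s (a * p + e))))) ⟩
  ⟪ f , (λ a → ⟪ composeₚ g (xpow p) , (λ e → s (a * p + e)) ⟫) ⟫
    ≡⟨ trans (pairing-* (composeₚ f (xpow p)) (composeₚ g (xpow p)) s) (pairing-composeₚ-xpow f p _) ⟨
  ⟪ composeₚ f (xpow p) *ₚ composeₚ g (xpow p) , s ⟫ ∎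
  where open ≡-Reasoning

composeₚ-prodₚ : ∀ fs p → composeₚ (prodₚ fs) (xpow p) ≋ prodₚ (map (λ f → composeₚ f (xpow p)) fs)
composeₚ-prodₚ []       p = mk≋ λ s → trans (pairing-composeₚ-xpow oneₚ p s) refl
composeₚ-prodₚ (f ∷ fs) p = ≋-trans (composeₚ-* f (prodₚ fs) p) (*ₚ-cong (≋-refl {composeₚ f (xpow p)}) (composeₚ-prodₚ fs p))

composeₚ-xpowMinus1 : ∀ n p → composeₚ (xpowMinus1 n) (xpow p) ≋ xpowMinus1 (n * p)
composeₚ-xpowMinus1 n p = mk≋ λ s → begin
  ⟪ composeₚ (xpowMinus1 n) (xpow p) , s ⟫   ≡⟨ pairing-composeₚ-xpow (xpowMinus1 n) p s ⟩
  ⟪ xpowMinus1 n , (λ e → s (e * p)) ⟫       ≡⟨ pairing-xpowMinus1 n (λ e → s (e * p)) ⟩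
  s (n * p) ℤ.- s 0                          ≡⟨ pairing-xpowMinus1 (n * p) s ⟨
  ⟪ xpowMinus1 (n * p) , s ⟫                 ∎
  where open ≡-Reasoning

monic-composeₚ : ∀ f {d p} → 0 < p → Monic f d → Monic (composeₚ f (xpow p)) (d * p)
monic-composeₚ f {d} {p@(suc _)} _ (fd , f>d) =
  trans (coeff-composeₚ (d * p)) (trans (pairing-congʳ f (λ e → δ-*p d e)) (trans (pairing-δ f d) fd)) ,
  λ {k} dp<k → trans (coeff-composeₚ k) (pairing-zero f (vanish dp<k))
  where
  coeff-composeₚ : ∀ k → coeff (composeₚ f (xpow p)) k ≡ ⟪ f , (λ e → δ k (e * p)) ⟫
  coeff-composeₚ k =
    trans (sym (pairing-δ (composeₚ f (xpow p)) k)) (pairing-composeₚ-xpow f p (δ k))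
  δ-*p : ∀ d e → δ (d * p) (e * p) ≡ δ d e
  δ-*p d e with d ℕ.≟ e
  ... | yes refl = trans (δ-refl (d * p)) (sym (δ-refl d))
  ... | no  d≢e  = trans (δ-≢ (d≢e ∘ ℕ.*-cancelʳ-≡ d e p)) (sym (δ-≢ d≢e))
  vanish : ∀ {k} → d * p < k → ∀ e → coeff f e ≡ 0ℤ ⊎ δ k (e * p) ≡ 0ℤ
  vanish {k} dp<k e with suc d ℕ.≤? e
  ... | yes d<e = inj₁ (f>d d<e)
  ... | no  d≮e = inj₂ (δ-≢ (ℕ.>⇒≢ (ℕ.≤-<-trans (ℕ.*-monoˡ-≤ p (ℕ.≤-pred (ℕ.≰⇒> d≮e))) dp<k)))

-- Exactness of the divisions that define Φ

prodₚ-++ : ∀ fs gs → prodₚ (fs ++ gs) ≋ prodₚ fs *ₚ prodₚ gs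
prodₚ-++ []       gs = ≋-sym (*ₚ-identityˡ (prodₚ gs))
prodₚ-++ (f ∷ fs) gs =
  ≋-trans (*ₚ-cong (≋-refl {f}) (prodₚ-++ fs gs)) (≋-sym (*ₚ-assoc f (prodₚ fs) (prodₚ gs)))

prodₚ-map-↭ : ∀ {A : Set} (f : A → Poly) {xs ys} → xs ↭ ys → prodₚ (map f xs) ≋ prodₚ (map f ys)
prodₚ-map-↭ f _↭_.refl = ≋-refl
prodₚ-map-↭ f (_↭_.prep x p) = *ₚ-cong (≋-refl {f x}) (prodₚ-map-↭ f p)
prodₚ-map-↭ f (_↭_.swap {xs} {ys} x y p) = begin
  f x *ₚ (f y *ₚ prodₚ (map f xs))
    ≈⟨ solve 3 (λ a b c → (a ⊗ (b ⊗ c)) ⊜ (b ⊗ (a ⊗ c))) ≋-refl (f x) (f y) (prodₚ (map f xs)) ⟩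
  f y *ₚ (f x *ₚ prodₚ (map f xs))
    ≈⟨ *ₚ-cong (≋-refl {f y}) (*ₚ-cong (≋-refl {f x}) (prodₚ-map-↭ f p)) ⟩
  f y *ₚ (f x *ₚ prodₚ (map f ys)) ∎
  where open ≋-Reasoning
prodₚ-map-↭ f (_↭_.trans p q) = ≋-trans (prodₚ-map-↭ f p) (prodₚ-map-↭ f q)

prodₚ-map-++ : ∀ {A : Set} (f : A → Poly) xs ys →
  prodₚ (map f (xs ++ ys)) ≋ prodₚ (map f xs) *ₚ prodₚ (map f ys)
prodₚ-map-++ f xs ys =
  subst (λ l → prodₚ l ≋ prodₚ (map f xs) *ₚ prodₚ (map f ys)) (sym (List.map-++ f xs ys)) (prodₚ-++ (map f xs) (map f ys))

-- Lists without repetition are determined by their members up to permutation, so the product over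
-- the members of `ys` outside `xs` is a cofactor.
prodₚ-map-⊆ : ∀ (f : ℕ → Poly) {xs ys} → Unique xs → Unique ys → (∀ {x} → x ∈ xs → x ∈ ys) →
  prodₚ (map f xs) ∣ₚ prodₚ (map f ys)
prodₚ-map-⊆ f {xs} {ys} xs! ys! xs⊆ys = prodₚ (map f rest) ,ₚ (begin
  prodₚ (map f rest) *ₚ prodₚ (map f xs)   ≈⟨ *ₚ-comm (prodₚ (map f rest)) (prodₚ (map f xs)) ⟩
  prodₚ (map f xs) *ₚ prodₚ (map f rest)   ≈⟨ prodₚ-map-++ f xs rest ⟨
  prodₚ (map f (xs ++ rest))               ≈⟨ prodₚ-map-↭ f xs++rest↭ys ⟩
  prodₚ (map f ys)                         ∎)
  where
  open ≋-Reasoning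
  new? = λ x → ¬? (x ∈? xs)
  rest = filter new? ys
  xs++rest! : Unique (xs ++ rest)
  xs++rest! = Unique.++⁺ xs! (Unique.filter⁺ new? ys!)
    λ (x∈xs , x∈rest) → proj₂ (∈-filter⁻ new? {xs = ys} x∈rest) x∈xs
  split : ∀ {x} → x ∈ ys → x ∈ xs ++ rest
  split {x} x∈ys with x ∈? xs
  ... | yes x∈xs = ∈-++⁺ˡ x∈xs
  ... | no  x∉xs = ∈-++⁺ʳ xs (∈-filter⁺ new? x∈ys x∉xs)
  xs++rest↭ys : xs ++ rest ↭ ys
  xs++rest↭ys = ∼bag⇒↭ (unique∧set⇒bag xs++rest! ys! (mk⇔
    (λ x∈ → [ xs⊆ys , (λ x∈rest → proj₁ (∈-filter⁻ new? x∈rest)) ]′ (∈-++⁻ xs x∈)) split))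

∈-properDivisors⁻ : ∀ {n d} → d ∈ properDivisors n → d ∣ n × 0 < d × d < n
∈-properDivisors⁻ {n} d∈
  with d∈range , d∣n ← ∈-filter⁻ (_∣? n) {xs = map suc (upTo (n ∸ 1))} d∈
  with k , k∈ , refl ← ∈-map⁻ suc d∈range
  = d∣n , s≤s z≤n , lemma n (∈-upTo⁻ k∈)
  where
  lemma : ∀ n {k} → k < n ∸ 1 → suc k < n
  lemma (suc n) k<n = s≤s k<n

∈-properDivisors⁺ : ∀ {n d} → d ∣ n → 0 < d → d < n → d ∈ properDivisors n
∈-properDivisors⁺ {suc n} {suc d} d∣n _ (s≤s d<n) =
  ∈-filter⁺ (_∣? suc n) (∈-map⁺ suc (∈-upTo⁺ d<n)) d∣n

properDivisors! : ∀ n → Unique (properDivisors n)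
properDivisors! n = Unique.filter⁺ (_∣? n) (Unique.map⁺ ℕ.suc-injective (Unique.upTo⁺ (n ∸ 1)))

-- With `n` at the head, the product of Φ over this list unfolds by computation to the left side of
-- `product≋`.
divisors : ℕ → List ℕ
divisors n = n ∷ properDivisors n

divisors! : ∀ n → Unique (divisors n)
divisors! n = All.tabulate (λ d∈ n≡d → ℕ.<⇒≢ (proj₂ (proj₂ (∈-properDivisors⁻ d∈))) (sym n≡d))
              ∷ properDivisors! n

∈-divisors⁻ : ∀ {n d} → 0 < n → d ∈ divisors n → d ∣ n × 0 < d
∈-divisors⁻ 0<n (here refl) = ∣-refl , 0<n
∈-divisors⁻ 0<n (there d∈)  = let d∣n , 0<d , _ = ∈-properDivisors⁻ d∈ in d∣n , 0<d

∣⇒0< : ∀ {d n} → 0 < n → d ∣ n → 0 < d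
∣⇒0< {zero}  0<n 0∣n with refl ← 0∣⇒≡0 0∣n = 0<n
∣⇒0< {suc d} _   _   = s≤s z≤n

∈-divisors⁺ : ∀ {n d} → 0 < n → d ∣ n → d ∈ divisors n
∈-divisors⁺ {n} {d} 0<n d∣n with d ℕ.≟ n
... | yes refl = here refl
... | no  d≢n  = there (∈-properDivisors⁺ d∣n (∣⇒0< 0<n d∣n)
                   (ℕ.≤∧≢⇒< (∣⇒≤ {{ℕ.>-nonZero 0<n}} d∣n) d≢n))

-- Recursive calls go to proper divisors only, so the index drops at least as fast as the fuel.
cycF-fuel : ∀ k l {n} → n < k → n < l → cycF k n ≡ cycF l n
cycF-fuel (suc k) (suc l) {n} (s≤s n≤k) (s≤s n≤l) =
  cong (λ fs → quotₚ (xpowMinus1 n) (prodₚ fs)) (List.map-cong-local (All.tabulate λ d∈ →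
    let _ , _ , d<n = ∈-properDivisors⁻ d∈
    in cycF-fuel k l (ℕ.<-≤-trans d<n n≤k) (ℕ.<-≤-trans d<n n≤l)))

-- Inside `Φ n` a divisor d is evaluated with fuel n, while `Φ d` has fuel d + 1; both exceed d.
Φ-unfold : ∀ n → Φ n ≡ quotₚ (xpowMinus1 n) (prodₚ (map Φ (properDivisors n)))
Φ-unfold n = cong (λ fs → quotₚ (xpowMinus1 n) (prodₚ fs)) (List.map-cong-local (All.tabulate λ {d} d∈ →
  cycF-fuel n (suc d) (proj₂ (proj₂ (∈-properDivisors⁻ d∈))) ℕ.≤-refl))

-- The invariant of the induction on the index: `product≋` says that the division defining `Φ n`
-- leaves no remainder, and `monic` makes `Φ n` admissible in the divisors of later divisions.
record Cyclotomic (n : ℕ) : Set where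
  constructor cyclotomic
  field
    monic    : IsMonic (Φ n)
    product≋ : Φ n *ₚ prodₚ (map Φ (properDivisors n)) ≋ xpowMinus1 n

  factor-∣ₚ : Φ n ∣ₚ xpowMinus1 n
  factor-∣ₚ = prodₚ (map Φ (properDivisors n)) ,ₚ
    ≋-trans (*ₚ-comm (prodₚ (map Φ (properDivisors n))) (Φ n)) product≋

-- With g = gcd a b < b, x^g − 1 divides the cofactor of Φ b in x^b − 1, so Φ b divides
-- 1 + x^g + ⋯ + x^(b−g), which is b / g modulo x^g − 1; and x^g − 1 lies in the ideal generated by
-- x^a − 1 and x^b − 1.
comaximal-from-gcd : ∀ {a b} → 0 < b → gcd a b < b → Cyclotomic a → Cyclotomic b →
  Cyclotomic (gcd a b) → IntComaximal (Φ a) (Φ b)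
comaximal-from-gcd {a} {b} 0<b g<b cyc-a cyc-b cyc-g =
  combine (gcd[m,n]∣n a b)
  where
  open ≋-Reasoning
  open Cyclotomic
  g = gcd a b
  Pa = prodₚ (map Φ (properDivisors a))
  Pb = prodₚ (map Φ (properDivisors b))
  0<g : 0 < g
  0<g = ∣⇒0< 0<b (gcd[m,n]∣n a b)
  x^g-1∣Pb : xpowMinus1 g ∣ₚ Pb
  x^g-1∣Pb = let q ,ₚ h = prodₚ-map-⊆ Φ (divisors! g) (properDivisors! b) λ d∈ →
                   let d∣g , 0<d = ∈-divisors⁻ 0<g d∈
                   in ∈-properDivisors⁺ (∣-trans d∣g (gcd[m,n]∣n a b)) 0<d
                        (ℕ.≤-<-trans (∣⇒≤ {{ℕ.>-nonZero 0<g}} d∣g) g<b)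
             in q ,ₚ ≋-trans (*ₚ-cong (≋-refl {q}) (≋-sym (product≋ cyc-g))) h
  combine : g ∣ b → IntComaximal (Φ a) (Φ b)
  combine (divides k b≡kg) =
    let S , T , b≋ , S≋ = geometric k g
        K ,ₚ Pb≋ = x^g-1∣Pb
        u , v , g≋ = xpowMinus1-gcd a b
        X = xpowMinus1 g
        KΦb≋S : K *ₚ Φ b ≋ S
        KΦb≋S = *-monic-cancelʳ {K *ₚ Φ b} {S} {X} (monic-xpowMinus1 0<g) (begin
          K *ₚ Φ b *ₚ X       ≈⟨ swap₃ K (Φ b) X ⟩
          Φ b *ₚ (K *ₚ X)     ≈⟨ *ₚ-cong (≋-refl {Φ b}) Pb≋ ⟩
          Φ b *ₚ Pb           ≈⟨ product≋ cyc-b ⟩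
          xpowMinus1 b        ≈⟨ subst (λ n → xpowMinus1 n ≋ S *ₚ X) (sym b≡kg) b≋ ⟩
          S *ₚ X              ∎)
    in negₚ (T *ₚ u *ₚ Pa) , K -ₚ T *ₚ v *ₚ Pb , + k ,
       (λ { refl → ℕ.<⇒≢ 0<b (sym b≡kg) }) , (begin
      negₚ (T *ₚ u *ₚ Pa) *ₚ Φ a +ₚ (K -ₚ T *ₚ v *ₚ Pb) *ₚ Φ b
        ≈⟨ regroup T u Pa (Φ a) K v Pb (Φ b) ⟩
      K *ₚ Φ b -ₚ T *ₚ (u *ₚ (Φ a *ₚ Pa) +ₚ v *ₚ (Φ b *ₚ Pb))
        ≈⟨ +ₚ-cong KΦb≋S (negₚ-cong (*ₚ-cong (≋-refl {T})
             (+ₚ-cong (*ₚ-cong (≋-refl {u}) (product≋ cyc-a)) (*ₚ-cong (≋-refl {v}) (product≋ cyc-b))))) ⟩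
      S -ₚ T *ₚ (u *ₚ xpowMinus1 a +ₚ v *ₚ xpowMinus1 b)
        ≈⟨ +ₚ-cong S≋ (negₚ-cong (*ₚ-cong (≋-refl {T}) g≋)) ⟩
      constₚ (+ k) +ₚ T *ₚ X -ₚ T *ₚ X
        ≈⟨ cancel (constₚ (+ k)) (T *ₚ X) ⟩
      constₚ (+ k) ∎)
    where
    swap₃ : ∀ f g h → f *ₚ g *ₚ h ≋ g *ₚ (f *ₚ h)
    swap₃ = solve 3 (λ f g h → (f ⊗ g ⊗ h) ⊜ (g ⊗ (f ⊗ h))) ≋-refl
    cancel : ∀ f g → f +ₚ g -ₚ g ≋ f
    cancel = solve 2 (λ f g → (f ⊕ g ⊕ ⊝ g) ⊜ f) ≋-refl
    regroup : ∀ T u P f K v Q h → negₚ (T *ₚ u *ₚ P) *ₚ f +ₚ (K -ₚ T *ₚ v *ₚ Q) *ₚ h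
      ≋ K *ₚ h -ₚ T *ₚ (u *ₚ (f *ₚ P) +ₚ v *ₚ (h *ₚ Q))
    regroup = solve 8 (λ T u P f K v Q h →
      ((⊝ (T ⊗ u ⊗ P)) ⊗ f ⊕ (K ⊕ ⊝ (T ⊗ v ⊗ Q)) ⊗ h)
      ⊜ (K ⊗ h ⊕ ⊝ (T ⊗ (u ⊗ (f ⊗ P) ⊕ v ⊗ (h ⊗ Q))))) ≋-refl

-- `comaximal-from-gcd` wants the gcd strictly below its second index. If gcd a b = b, then b is a
-- proper divisor of a, and exchanging the two indices restores this.
Φ-comaximal : ∀ {n} → (∀ {d} → d < n → 0 < d → Cyclotomic d) →
  ∀ {a b} → 0 < a → 0 < b → a < n → b < n → a ≢ b → IntComaximal (Φ a) (Φ b)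
Φ-comaximal {n} cyc {a} {b} 0<a 0<b a<n b<n a≢b with gcd a b ℕ.≟ b
... | no g≢b = comaximal-from-gcd 0<b g<b (cyc a<n 0<a) (cyc b<n 0<b)
                 (cyc (ℕ.<-trans g<b b<n) (∣⇒0< 0<b (gcd[m,n]∣n a b)))
  where g<b = ℕ.≤∧≢⇒< (∣⇒≤ {{ℕ.>-nonZero 0<b}} (gcd[m,n]∣n a b)) g≢b
... | yes g≡b = intComaximal-sym (comaximal-from-gcd 0<a g<a (cyc b<n 0<b) (cyc a<n 0<a)
                 (cyc (ℕ.<-trans g<a a<n) (∣⇒0< 0<a (gcd[m,n]∣n b a))))
  where
  g<a : gcd b a < a
  g<a = ℕ.≤∧≢⇒< (∣⇒≤ {{ℕ.>-nonZero 0<a}} (gcd[m,n]∣n b a))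
          (λ g≡a → a≢b (begin
            a        ≡⟨ g≡a ⟨
            gcd b a  ≡⟨ gcd-comm b a ⟩
            gcd a b  ≡⟨ g≡b ⟩
            b        ∎))
    where open ≡-Reasoning

allPairs-with : ∀ {A : Set} {P : A → Set} {R S : A → A → Set} →
  (∀ {x y} → P x → P y → R x y → S x y) → ∀ {xs} → All P xs → AllPairs R xs → AllPairs S xs
allPairs-with h []         []         = []
allPairs-with h (p ∷ ps) (rs ∷ rss) =
  All.zipWith (λ (py , r) → h p py r) (ps , rs) ∷ allPairs-with h ps rss

Φ-cyclotomic : ∀ n → 0 < n → Cyclotomic n
Φ-cyclotomic = <-rec (λ n → 0 < n → Cyclotomic n) step
  where
  step : ∀ n → (∀ {d} → d < n → 0 < d → Cyclotomic d) → 0 < n → Cyclotomic n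
  step n cyc 0<n =
    let bounds : All (λ d → d ∣ n × 0 < d × d < n) (properDivisors n)
        bounds = All.tabulate ∈-properDivisors⁻
        P = prodₚ (map Φ (properDivisors n))
        _ , P-monic = prodₚ-monic {map Φ (properDivisors n)} (All.map⁺ (All.map
          (λ (_ , 0<d , d<n) → Cyclotomic.monic (cyc d<n 0<d)) bounds))
        q ,ₚ qP≋ = prodₚ-∣ₚ {map Φ (properDivisors n)} {xpowMinus1 n}
          (All.map⁺ (All.map (λ (_ , 0<d , d<n) → Cyclotomic.monic (cyc d<n 0<d)) bounds))
          (AllPairs.map⁺ (allPairs-with (λ (_ , 0<a , a<n) (_ , 0<b , b<n) → Φ-comaximal cyc 0<a 0<b a<n b<n)
                                        bounds (properDivisors! n)))
          (All.map⁺ (All.map (λ (d∣n , 0<d , d<n) →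
             ∣ₚ-trans (Cyclotomic.factor-∣ₚ (cyc d<n 0<d)) (xpowMinus1-∣ d∣n)) bounds))
        Φ≋q : Φ n ≋ q
        Φ≋q = subst (_≋ q) (sym (Φ-unfold n))
                (quotₚ-exact {xpowMinus1 n} {P} P-monic (≋-trans (≋-sym qP≋) (*ₚ-comm q P)))
        -- The quotient inherits leading coefficient 1 from x^n - 1 and the divisor, both of which
        -- are monic.
        e , q-monic , _ = monic-cofactor q {P} P-monic
          (leads-resp-≋ {xpowMinus1 n} {q *ₚ P} (≋-sym qP≋) (monic-xpowMinus1 0<n))
    in cyclotomic (e , leads-resp-≋ {q} {Φ n} (≋-sym Φ≋q) q-monic)
                  (≋-trans (*ₚ-cong Φ≋q (≋-refl {P})) qP≋)

open Cyclotomic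

-- Cyclotomic polynomials of index m p

∣-*-prime : ∀ {p m d} → Prime p → d ∣ m * p → d ∣ m ⊎ ∃ λ e → d ≡ e * p × e ∣ m
∣-*-prime {p} {m} {d} p-prime d∣mp with p ∣? d
... | yes (divides e refl) = inj₂ (e , refl , *-cancelʳ-∣ p {{prime⇒nonZero p-prime}} d∣mp)
... | no  p∤d = inj₁ (coprime-divisor coprime (subst (d ∣_) (ℕ.*-comm m p) d∣mp))
  where
  coprime : Coprime d p
  coprime {i} (i∣d , i∣p) with prime⇒irreducible p-prime i∣p
  ... | inj₁ i≡1 = i≡1
  ... | inj₂ refl = contradiction i∣d p∤d

-- Sorted by divisibility by p. The condition p ∤ m keeps the halves disjoint, since a multiple of p
-- cannot divide m.
divisors-*-prime : ∀ {p m} → Prime p → ¬ p ∣ m → 0 < m →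
  divisors (m * p) ↭ divisors m ++ map (_* p) (divisors m)
divisors-*-prime {p} {m} p-prime p∤m 0<m = ∼bag⇒↭ (unique∧set⇒bag (divisors! (m * p)) split! (mk⇔ to from))
  where
  instance
    _ = prime⇒nonZero p-prime
  0<mp : 0 < m * p
  0<mp = ℕ.*-mono-≤ 0<m (ℕ.>-nonZero⁻¹ p)
  split! : Unique (divisors m ++ map (_* p) (divisors m))
  split! = Unique.++⁺ (divisors! m) (Unique.map⁺ (λ {d} {e} → ℕ.*-cancelʳ-≡ d e p) (divisors! m))
    λ (d∈ , d∈′) → let e , _ , d≡ep = ∈-map⁻ (_* p) {xs = divisors m} d∈′
                   in p∤m (∣-trans (divides e d≡ep) (proj₁ (∈-divisors⁻ {m} 0<m d∈)))
  to : ∀ {d} → d ∈ divisors (m * p) → d ∈ divisors m ++ map (_* p) (divisors m)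
  to d∈ with ∣-*-prime p-prime (proj₁ (∈-divisors⁻ {m * p} 0<mp d∈))
  ... | inj₁ d∣m              = ∈-++⁺ˡ (∈-divisors⁺ {m} 0<m d∣m)
  ... | inj₂ (e , refl , e∣m) = ∈-++⁺ʳ (divisors m) (∈-map⁺ (_* p) {xs = divisors m} (∈-divisors⁺ {m} 0<m e∣m))
  from : ∀ {d} → d ∈ divisors m ++ map (_* p) (divisors m) → d ∈ divisors (m * p)
  from d∈ with ∈-++⁻ (divisors m) d∈
  ... | inj₁ d∈m = ∈-divisors⁺ {m * p} 0<mp (∣m⇒∣m*n p (proj₁ (∈-divisors⁻ {m} 0<m d∈m)))
  ... | inj₂ d∈mp with e , e∈ , refl ← ∈-map⁻ (_* p) {xs = divisors m} d∈mp =
    ∈-divisors⁺ {m * p} 0<mp (*-monoˡ-∣ p (proj₁ (∈-divisors⁻ {m} 0<m e∈)))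

prodₚ-map-* : ∀ {f g h : ℕ → Poly} {xs} → All (λ d → f d *ₚ g d ≋ h d) xs →
  prodₚ (map f xs) *ₚ prodₚ (map g xs) ≋ prodₚ (map h xs)
prodₚ-map-* []                              = *ₚ-identityˡ oneₚ
prodₚ-map-* {f} {g} {h} {x ∷ xs} (eq ∷ eqs) = begin
  f x *ₚ F *ₚ (g x *ₚ G)   ≈⟨ interchange (f x) F (g x) G ⟩
  f x *ₚ g x *ₚ (F *ₚ G)   ≈⟨ *ₚ-cong eq (prodₚ-map-* {f} {g} {h} eqs) ⟩
  h x *ₚ prodₚ (map h xs)  ∎
  where
  open ≋-Reasoning
  F = prodₚ (map f xs)
  G = prodₚ (map g xs)
  interchange : ∀ a b c d → a *ₚ b *ₚ (c *ₚ d) ≋ a *ₚ c *ₚ (b *ₚ d)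
  interchange = solve 4 (λ a b c d → (a ⊗ b ⊗ (c ⊗ d)) ⊜ (a ⊗ c ⊗ (b ⊗ d))) ≋-refl

-- Let `X` and `Y` be the products of Φ_d and of Φ_dp over the proper divisors d of m. Multiplied by
-- the monic polynomial Y X, both sides become x^(mp) - 1: the left by splitting the divisors of m
-- p, the right because the induction hypotheses turn X(x^p) into Y X.
Φ-*-prime : ∀ {p} → Prime p → ∀ m → ¬ p ∣ m → 0 < m → Φ (m * p) *ₚ Φ m ≋ composeₚ (Φ m) (xpow p)
Φ-*-prime {p} p-prime = <-rec Goal step
  where
  open ≋-Reasoning
  instance
    _ = prime⇒nonZero p-prime
  Goal : ℕ → Set
  Goal m = ¬ p ∣ m → 0 < m → Φ (m * p) *ₚ Φ m ≋ composeₚ (Φ m) (xpow p)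
  step : ∀ m → (∀ {d} → d < m → Goal d) → Goal m
  step m IH p∤m 0<m = *-monic-cancelʳ {Φ (m * p) *ₚ Φ m} {composeₚ (Φ m) (xpow p)} {Y *ₚ X}
    (monic-* Y (proj₂ Y-monic) (proj₂ X-monic)) (begin
      Φ (m * p) *ₚ Φ m *ₚ (Y *ₚ X)        ≈⟨ regroup (Φ (m * p)) (Φ m) Y X ⟩
      Φ m *ₚ X *ₚ (Φ (m * p) *ₚ Y)        ≈⟨ factorisation ⟨
      xpowMinus1 (m * p)                  ≈⟨ composeₚ-xpowMinus1 m p ⟨
      composeₚ (xpowMinus1 m) (xpow p)    ≈⟨ composeₚ-cong p (product≋ (Φ-cyclotomic m 0<m)) ⟨
      composeₚ (Φ m *ₚ X) (xpow p)        ≈⟨ composeₚ-* (Φ m) X p ⟩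
      composeₚ (Φ m) (xpow p) *ₚ composeₚ X (xpow p)
        ≈⟨ *ₚ-cong (≋-refl {composeₚ (Φ m) (xpow p)}) composed ⟩
      composeₚ (Φ m) (xpow p) *ₚ (Y *ₚ X) ∎)
    where
    X = prodₚ (map Φ (properDivisors m))
    Y = prodₚ (map (λ d → Φ (d * p)) (properDivisors m))
    0<*p : ∀ {d} → 0 < d → 0 < d * p
    0<*p 0<d = ℕ.*-mono-≤ 0<d (ℕ.>-nonZero⁻¹ p)
    X-monic : IsMonic X
    X-monic = prodₚ-monic (All.map⁺ {xs = properDivisors m} (All.tabulate λ {d} d∈ →
      monic (Φ-cyclotomic d (proj₁ (proj₂ (∈-properDivisors⁻ {m} d∈))))))
    Y-monic : IsMonic Y
    Y-monic = prodₚ-monic (All.map⁺ {xs = properDivisors m} (All.tabulate λ {d} d∈ →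
      monic (Φ-cyclotomic (d * p) (0<*p (proj₁ (proj₂ (∈-properDivisors⁻ {m} d∈)))))))
    regroup : ∀ a b c d → a *ₚ b *ₚ (c *ₚ d) ≋ b *ₚ d *ₚ (a *ₚ c)
    regroup = solve 4 (λ a b c d → (a ⊗ b ⊗ (c ⊗ d)) ⊜ (b ⊗ d ⊗ (a ⊗ c))) ≋-refl
    factorisation : xpowMinus1 (m * p) ≋ Φ m *ₚ X *ₚ (Φ (m * p) *ₚ Y)
    factorisation = begin
      xpowMinus1 (m * p)
        ≈⟨ product≋ (Φ-cyclotomic (m * p) (0<*p 0<m)) ⟨
      prodₚ (map Φ (divisors (m * p)))
        ≈⟨ prodₚ-map-↭ Φ (divisors-*-prime p-prime p∤m 0<m) ⟩
      prodₚ (map Φ (divisors m ++ map (_* p) (divisors m)))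
        ≈⟨ prodₚ-map-++ Φ (divisors m) (map (_* p) (divisors m)) ⟩
      prodₚ (map Φ (divisors m)) *ₚ prodₚ (map Φ (map (_* p) (divisors m)))
        ≡⟨ cong (λ l → prodₚ (map Φ (divisors m)) *ₚ prodₚ l) (List.map-∘ {g = Φ} {f = _* p} (divisors m)) ⟨
      Φ m *ₚ X *ₚ (Φ (m * p) *ₚ Y) ∎
    composed : composeₚ X (xpow p) ≋ Y *ₚ X
    composed = begin
      composeₚ X (xpow p)
        ≈⟨ composeₚ-prodₚ (map Φ (properDivisors m)) p ⟩
      prodₚ (map (λ f → composeₚ f (xpow p)) (map Φ (properDivisors m)))
        ≡⟨ cong prodₚ (List.map-∘ (properDivisors m)) ⟨
      prodₚ (map (λ d → composeₚ (Φ d) (xpow p)) (properDivisors m))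
        ≈⟨ prodₚ-map-* {λ d → Φ (d * p)} {Φ} {λ d → composeₚ (Φ d) (xpow p)} {properDivisors m} (All.tabulate λ d∈ →
             let d∣m , 0<d , d<m = ∈-properDivisors⁻ {m} d∈
             in IH d<m (λ p∣d → p∤m (∣-trans p∣d d∣m)) 0<d) ⟨
      Y *ₚ X ∎

-- The degrees of Φ_m and Ψ_m

prime-divisor : ∀ m → 1 < m → ∃ λ p → Prime p × p ∣ m
prime-divisor m 1<m = let instance _ = ℕ.>-nonZero (ℕ.<-trans (s≤s z≤n) 1<m)
                          open PrimeFactorisation (factorise m)
                      in find factors isFactorisation factorsPrime
  where
  find : ∀ ps → m ≡ product ps → All Prime ps → ∃ λ p → Prime p × p ∣ m
  find []       m≡1 _             = contradiction (sym m≡1) (ℕ.<⇒≢ 1<m)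
  find (p ∷ ps) m≡  (p-prime ∷ _) = p , p-prime , divides (product ps) (trans m≡ (ℕ.*-comm p (product ps)))

Squarefree : ℕ → Set
Squarefree m = ∀ d → d * d ∣ m → d ≡ 1

-- For m = k p with p prime, degrees in Φ_kp(x) Φ_k(x) = Φ_k(x^p) give deg Φ_kp = (p - 1) deg Φ_k,
-- which is positive by induction. If p divided k, then p² would divide m.
Φ-degree-positive : ∀ m → 0 < m → Squarefree m → ∃ λ d → 0 < d × Monic (Φ m) d
Φ-degree-positive = <-rec (λ m → 0 < m → Squarefree m → ∃ λ d → 0 < d × Monic (Φ m) d) step
  where
  step : ∀ m → (∀ {k} → k < m → 0 < k → Squarefree k → ∃ λ d → 0 < d × Monic (Φ k) d) →
         0 < m → Squarefree m → ∃ λ d → 0 < d × Monic (Φ m) d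
  step m IH 0<m m-sqfree with m ℕ.≟ 1
  -- 1 has no proper divisors, so Φ_1 is x - 1 itself.
  ... | yes refl = 1 , s≤s z≤n , leads-resp-≋ {xpowMinus1 1} {Φ 1}
    (≋-trans (≋-sym (product≋ (Φ-cyclotomic 1 0<m))) (≋-trans (*ₚ-comm (Φ 1) oneₚ) (*ₚ-identityˡ (Φ 1))))
    (monic-xpowMinus1 {1} (s≤s z≤n))
  ... | no m≢1 with prime-divisor m (ℕ.≤∧≢⇒< 0<m (m≢1 ∘ sym))
  ...   | p , p-prime , divides k refl =
    let d , 0<d , Φk-monic = IH k<kp 0<k (λ e e²∣k → m-sqfree e (∣m⇒∣m*n p e²∣k))
        e , Φkp-monic , e+d≡dp = monic-cofactor (Φ (k * p)) {Φ k} Φk-monic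
          (leads-resp-≋ {composeₚ (Φ k) (xpow p)} {Φ (k * p) *ₚ Φ k}
             (≋-sym (Φ-*-prime p-prime k p∤k 0<k))
             (monic-composeₚ (Φ k) 0<p Φk-monic))
    in e , positive e 0<d e+d≡dp , Φkp-monic
    where
    instance
      _ = prime⇒nonZero p-prime
      _ = prime⇒nonTrivial p-prime
    0<p = ℕ.>-nonZero⁻¹ p
    1<p = ℕ.nonTrivial⇒n>1 p
    0<k : 0 < k
    0<k = ∣⇒0< 0<m (m∣m*n p)
    k<kp : k < k * p
    k<kp = ℕ.m<m*n k p {{ℕ.>-nonZero 0<k}} 1<p
    p∤k : ¬ p ∣ k
    p∤k p∣k = ℕ.<⇒≢ 1<p (sym (m-sqfree p (*-monoˡ-∣ p p∣k)))
    positive : ∀ e {d} → 0 < d → e + d ≡ d * p → 0 < e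
    positive zero    {d} 0<d d≡dp = contradiction d≡dp (ℕ.<⇒≢ (ℕ.m<m*n d p {{ℕ.>-nonZero 0<d}} 1<p))
    positive (suc e) _   _    = s≤s z≤n

Ψ-cofactor : ∀ m → 0 < m → Φ m *ₚ Ψ m ≋ xpowMinus1 m
Ψ-cofactor m 0<m = ≋-trans (*ₚ-cong (≋-refl {Φ m}) Ψ≋) (product≋ (Φ-cyclotomic m 0<m))
  where
  Ψ≋ : Ψ m ≋ prodₚ (map Φ (properDivisors m))
  Ψ≋ = quotₚ-exact {xpowMinus1 m} {Φ m} (proj₂ (monic (Φ-cyclotomic m 0<m)))
         (≋-sym (product≋ (Φ-cyclotomic m 0<m)))

Ψ-degree : ∀ m → 0 < m → Squarefree m → DegreeBelow (Ψ m) m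
Ψ-degree m 0<m m-sqfree {k} m≤k =
  let d , 0<d , Φ-monic = Φ-degree-positive m 0<m m-sqfree
      e , (_ , Ψ>e) , e+d≡m = monic-cofactor (Ψ m) {Φ m} Φ-monic
        (leads-resp-≋ {xpowMinus1 m} {Ψ m *ₚ Φ m}
           (≋-trans (≋-sym (Ψ-cofactor m 0<m)) (*ₚ-comm (Φ m) (Ψ m))) (monic-xpowMinus1 0<m))
  in Ψ>e (ℕ.≤-trans (subst (e <_) e+d≡m (ℕ.m<m+n e 0<d)) m≤k)

-- Truncation and blocks

coeff-take-< : ∀ f {n k} → k < n → coeff (take n f) k ≡ coeff f k
coeff-take-< []      {suc n}         _         = refl
coeff-take-< (c ∷ f) {suc n} {zero}  _         = refl
coeff-take-< (c ∷ f) {suc n} {suc k} (s≤s k<n) = coeff-take-< f k<n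

coeff-take-≥ : ∀ f {n k} → n ≤ k → coeff (take n f) k ≡ 0ℤ
coeff-take-≥ f       {zero}  _         = refl
coeff-take-≥ []      {suc n} _         = refl
coeff-take-≥ (c ∷ f) {suc n} (s≤s n≤k) = coeff-take-≥ f n≤k

coeff-drop : ∀ f n k → coeff (drop n f) k ≡ coeff f (n + k)
coeff-drop f       zero    k = refl
coeff-drop []      (suc n) k = refl
coeff-drop (c ∷ f) (suc n) k = coeff-drop f n k

coeff-block-< : ∀ f {s} i {k} → k < s → coeff (block f s i) k ≡ coeff f (i * s + k)
coeff-block-< f {s} i {k} k<s = trans (coeff-take-< (drop (i * s) f) k<s) (coeff-drop f (i * s) k)

coeff-block-≥ : ∀ f {s} i {k} → s ≤ k → coeff (block f s i) k ≡ 0ℤ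
coeff-block-≥ f {s} i = coeff-take-≥ (drop (i * s) f)

-- Truncating the polynomial is dual to cutting off the sequence. Later `t` vanishes from i + 1 on,
-- which turns a sum over all of Φ_m into one over its truncation.
pairing-take : ∀ n f {s t} → (∀ e → e < n → s e ≡ t e) → (∀ e → n ≤ e → t e ≡ 0ℤ) →
  ⟪ take n f , s ⟫ ≡ ⟪ f , t ⟫
pairing-take zero    f       {s} {t} _ h = sym (pairing-zero f (λ e → inj₂ (h e z≤n)))
pairing-take (suc n) []      _ _ = refl
pairing-take (suc n) (c ∷ f) h h′ = cong₂ (λ a b → c ℤ.* a ℤ.+ b) (h 0 (s≤s z≤n))
  (pairing-take n f (λ e e<n → h (suc e) (s≤s e<n)) (λ e n≤e → h′ (suc e) (s≤s n≤e)))

pairing-drop : ∀ n f s → ⟪ f , s ⟫ ≡ ⟪ take n f , s ⟫ ℤ.+ ⟪ drop n f , (λ e → s (n + e)) ⟫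
pairing-drop zero    f       s = sym (ℤ.+-identityˡ _)
pairing-drop (suc n) []      s = refl
pairing-drop (suc n) (c ∷ f) s =
  trans (cong (ℤ._+_ (c ℤ.* s 0)) (pairing-drop n f (s ∘ suc))) (sym (ℤ.+-assoc (c ℤ.* s 0) _ _))

𝒯-take : ∀ n f → 𝒯 n f ≋ take n f
𝒯-take n f = proj₂ (quotₚ-remₚ-unique {f} {xpow n} {n} {drop n f} {take n f}
  (monic-xpow n) (coeff-take-≥ f) (mk≋ λ s → begin
    ⟪ f , s ⟫
      ≡⟨ pairing-drop n f s ⟩
    ⟪ take n f , s ⟫ ℤ.+ ⟪ drop n f , (λ e → s (n + e)) ⟫
      ≡⟨ ℤ.+-comm ⟪ take n f , s ⟫ _ ⟩
    ⟪ drop n f , (λ e → s (n + e)) ⟫ ℤ.+ ⟪ take n f , s ⟫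
      ≡⟨ cong (ℤ._+ ⟪ take n f , s ⟫) (trans (pairing-* (xpow n) (drop n f) s)
           (pairing-xpow n (λ e → ⟪ drop n f , (λ e′ → s (e + e′)) ⟫))) ⟨
    ⟪ xpow n *ₚ drop n f , s ⟫ ℤ.+ ⟪ take n f , s ⟫
      ≡⟨ pairing-+ˡ (xpow n *ₚ drop n f) (take n f) s ⟨
    ⟪ xpow n *ₚ drop n f +ₚ take n f , s ⟫ ∎))
  where open ≡-Reasoning

-- Indicator functions of residue classes

𝟙 : {P : Set} → Dec P → ℤ
𝟙 P? = if does P? then 1ℤ else 0ℤ

𝟙-cong : ∀ {P Q : Set} (P? : Dec P) (Q? : Dec Q) → (P → Q) → (Q → P) → 𝟙 P? ≡ 𝟙 Q?
𝟙-cong (yes p) (yes q) _   _   = refl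
𝟙-cong (yes p) (no ¬q) p→q _   = contradiction (p→q p) ¬q
𝟙-cong (no ¬p) (yes q) _   q→p = contradiction (q→p q) ¬p
𝟙-cong (no ¬p) (no ¬q) _   _   = refl

𝟙-yes : ∀ {P : Set} (P? : Dec P) → P → 𝟙 P? ≡ 1ℤ
𝟙-yes (yes _) _ = refl
𝟙-yes (no ¬p) p = contradiction p ¬p

𝟙-no : ∀ {P : Set} (P? : Dec P) → ¬ P → 𝟙 P? ≡ 0ℤ
𝟙-no (yes p) ¬p = contradiction p ¬p
𝟙-no (no _)  _  = refl

module Residues (m : ℕ) .{{_ : NonZero m}} where

  %-congʳ-+ : ∀ c {x y} → x % m ≡ y % m → (c + x) % m ≡ (c + y) % m
  %-congʳ-+ c {x} {y} eq = begin
    (c + x) % m              ≡⟨ %-distribˡ-+ c x m ⟩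
    (c % m + x % m) % m      ≡⟨ cong (λ z → (c % m + z) % m) eq ⟩
    (c % m + y % m) % m      ≡⟨ %-distribˡ-+ c y m ⟨
    (c + y) % m              ∎
    where open ≡-Reasoning

  %-cancelˡ-+ : ∀ c {x y} → (c + x) % m ≡ (c + y) % m → x % m ≡ y % m
  %-cancelˡ-+ c {x} {y} eq =
    -- Adding c (m - 1) completes c to the multiple c m, which replaces subtraction of c.
    trans (sym (undo x)) (trans (%-congʳ-+ (c * pred m) eq) (undo y))
    where
    rearrange : ∀ c k x → c * k + (c + x) ≡ x + c * suc k
    rearrange = ℕ-Solver.solve-∀
    undo : ∀ x → (c * pred m + (c + x)) % m ≡ x % m
    undo x = trans (cong (_% m) (trans (rearrange c (pred m) x) (cong (λ l → x + c * l) (ℕ.suc-pred m))))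
                   ([m+kn]%n≡m%n x c m)

  %-gap : ∀ {a b} → a < b → a % m ≡ b % m → a + m ≤ b
  %-gap {a} {b} a<b eq = begin
    a + m                        ≡⟨ cong (_+ m) (m≡m%n+[m/n]*n a m) ⟩
    a % m + a / m * m + m        ≡⟨ rearrange (a % m) (a / m * m) m ⟩
    a % m + suc (a / m) * m      ≤⟨ ℕ.+-monoʳ-≤ (a % m) (ℕ.*-monoˡ-≤ m quotients) ⟩
    a % m + b / m * m            ≡⟨ cong (_+ b / m * m) eq ⟩
    b % m + b / m * m            ≡⟨ m≡m%n+[m/n]*n b m ⟨
    b                            ∎
    where
    open ℕ.≤-Reasoning
    rearrange : ∀ x y z → x + y + z ≡ x + (z + y)
    rearrange = ℕ-Solver.solve-∀
    quotients : a / m < b / m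
    quotients = ℕ.*-cancelʳ-< m (a / m) (b / m) (ℕ.+-cancelˡ-< (b % m) _ _
      (subst₂ _<_ (trans (m≡m%n+[m/n]*n a m) (cong (_+ a / m * m) eq)) (m≡m%n+[m/n]*n b m) a<b))

  ResidueBelow? : ∀ n e → Dec (e ≤ n × e % m ≡ n % m)
  ResidueBelow? n e = (e ℕ.≤? n) ×-dec (e % m ℕ.≟ n % m)

  -- Pairing with f gives the coefficient of x^n in the power series f / (1 - x^m).
  residueBelow : ℕ → ℕ → ℤ
  residueBelow n e = 𝟙 (ResidueBelow? n e)

  -- For k < m, pairing with f gives the coefficient of x^k in the reduction of f modulo x^m - 1.
  residue : ℕ → ℕ → ℤ
  residue k e = 𝟙 (e % m ℕ.≟ k)

  0<m : 0 < m
  0<m = ℕ.>-nonZero⁻¹ m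

  -- A shift by m preserves the class. By `%-gap`, an exponent of the class below n is still at most
  -- n after the shift, so the range is left only from e = n.
  residueBelow-telescopes : ∀ n e → residueBelow n (e + m) ℤ.- residueBelow n e ≡ ℤ.- δ n e
  residueBelow-telescopes n e with n ℕ.≟ e
  ... | yes refl = trans (cong₂ ℤ._-_
    (𝟙-no (ResidueBelow? n (n + m)) (λ (n+m≤n , _) → ℕ.<⇒≱ (ℕ.m<m+n n 0<m) n+m≤n))
    (𝟙-yes (ResidueBelow? n n) (ℕ.≤-refl , refl))) (cong ℤ.-_ (sym (δ-refl n)))
  ... | no  n≢e = begin
    residueBelow n (e + m) ℤ.- residueBelow n e
      ≡⟨ cong (ℤ._- residueBelow n e) (𝟙-cong (ResidueBelow? n (e + m)) (ResidueBelow? n e)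
           (λ (e+m≤n , eq) → ℕ.m+n≤o⇒m≤o e e+m≤n , trans (sym ([m+n]%n≡m%n e m)) eq)
           (λ (e≤n , eq) → %-gap (ℕ.≤∧≢⇒< e≤n (n≢e ∘ sym)) eq , trans ([m+n]%n≡m%n e m) eq)) ⟩
    residueBelow n e ℤ.- residueBelow n e   ≡⟨ ℤ.+-inverseʳ (residueBelow n e) ⟩
    0ℤ                                      ≡⟨ cong ℤ.-_ (δ-≢ n≢e) ⟨
    ℤ.- δ n e                               ∎
    where open ≡-Reasoning

  pairing-*-xpowMinus1 : ∀ f s →
    ⟪ f *ₚ xpowMinus1 m , s ⟫ ≡ ⟪ f , (λ e → s (e + m) ℤ.- s e) ⟫
  pairing-*-xpowMinus1 f s = trans (pairing-* f (xpowMinus1 m) s) (pairing-congʳ f λ e →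
    trans (pairing-xpowMinus1 m (λ e′ → s (e + e′))) (cong (λ e′ → s (e + m) ℤ.- s e′) (ℕ.+-identityʳ e)))

  pairing-negʳ : ∀ f s → ⟪ f , (λ e → ℤ.- s e) ⟫ ≡ ℤ.- ⟪ f , s ⟫
  pairing-negʳ []      s = refl
  pairing-negʳ (c ∷ f) s = trans
    (cong₂ ℤ._+_ (sym (ℤ.neg-distribʳ-* c (s 0))) (pairing-negʳ f (s ∘ suc)))
    (sym (ℤ.neg-distrib-+ (c ℤ.* s 0) _))

  -- The transpose of multiplication by x^m - 1 sends this sequence to -δ_n. The sign is that of 1 /
  -- (x^m - 1) = -(1 + x^m + x^(2m) + ⋯), and it becomes the minus sign of the theorem.
  coeff-via-residueBelow : ∀ f n → ⟪ f *ₚ xpowMinus1 m , residueBelow n ⟫ ≡ ℤ.- coeff f n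
  coeff-via-residueBelow f n = begin
    ⟪ f *ₚ xpowMinus1 m , residueBelow n ⟫      ≡⟨ pairing-*-xpowMinus1 f (residueBelow n) ⟩
    ⟪ f , (λ e → residueBelow n (e + m) ℤ.- residueBelow n e) ⟫
                                                ≡⟨ pairing-congʳ f (residueBelow-telescopes n) ⟩
    ⟪ f , (λ e → ℤ.- δ n e) ⟫                   ≡⟨ pairing-negʳ f (δ n) ⟩
    ℤ.- ⟪ f , δ n ⟫                             ≡⟨ cong ℤ.-_ (pairing-δ f n) ⟩
    ℤ.- coeff f n                               ∎
    where open ≡-Reasoning

  -- `residue k` has period m, so multiples of x^m - 1 pair to zero with it; on the remainder, of
  -- degree below m, it coincides with `δ k`.
  coeff-via-residue : ∀ f {k} → k < m → coeff (remₚ f (xpowMinus1 m)) k ≡ ⟪ f , residue k ⟫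
  coeff-via-residue f {k} k<m = begin
    coeff r k                                          ≡⟨ pairing-δ r k ⟨
    ⟪ r , δ k ⟫                                        ≡⟨ pairing-congʳ-supp r agree ⟩
    ⟪ r , residue k ⟫                                  ≡⟨ pairing-+ˡ f (negₚ (X *ₚ q)) (residue k) ⟩
    ⟪ f , residue k ⟫ ℤ.+ ⟪ negₚ (X *ₚ q) , residue k ⟫
      ≡⟨ cong (ℤ._+_ ⟪ f , residue k ⟫) (trans (pairing-neg (X *ₚ q) (residue k)) (cong ℤ.-_ vanish)) ⟩
    ⟪ f , residue k ⟫ ℤ.+ 0ℤ                           ≡⟨ ℤ.+-identityʳ _ ⟩
    ⟪ f , residue k ⟫                                  ∎
    where
    open ≡-Reasoning
    X = xpowMinus1 m
    q = quotₚ f X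
    r = remₚ f X
    agree : ∀ e → coeff r e ≡ 0ℤ ⊎ δ k e ≡ residue k e
    agree e with m ℕ.≤? e
    ... | yes m≤e = inj₁ (remₚ-degree f X (monic-xpowMinus1 0<m) m≤e)
    ... | no  m≰e with k ℕ.≟ e
    ...   | yes refl = inj₂ (trans (δ-refl k) (sym (𝟙-yes (k % m ℕ.≟ k) (m<n⇒m%n≡m k<m))))
    ...   | no  k≢e  = inj₂ (trans (δ-≢ k≢e) (sym (𝟙-no (e % m ℕ.≟ k)
                         (λ eq → k≢e (trans (sym eq) (m<n⇒m%n≡m (ℕ.≰⇒> m≰e)))))))
    vanish : ⟪ X *ₚ q , residue k ⟫ ≡ 0ℤ
    vanish = begin
      ⟪ X *ₚ q , residue k ⟫                                   ≡⟨ pairing≡ (*ₚ-comm X q) (residue k) ⟩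
      ⟪ q *ₚ X , residue k ⟫                                   ≡⟨ pairing-*-xpowMinus1 q (residue k) ⟩
      ⟪ q , (λ e → residue k (e + m) ℤ.- residue k e) ⟫        ≡⟨ pairing-zero q (λ e → inj₂ (period e)) ⟩
      0ℤ                                                       ∎
      where
      period : ∀ e → residue k (e + m) ℤ.- residue k e ≡ 0ℤ
      period e = trans (cong (λ e′ → 𝟙 (e′ ℕ.≟ k) ℤ.- residue k e) ([m+n]%n≡m%n e m))
                       (ℤ.+-inverseʳ (residue k e))

-- Both sides of the theorem pair Φ m, up to degree i, with sums of coefficients of Ψ m over the same
-- residue class.
module Blocks (m p : ℕ) .{{_ : NonZero m}} (m-sqfree : Squarefree m) (p-prime : Prime p) (p∤m : ¬ p ∣ m) where

  open Residues m

  private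
    r = p % m

  -- The exponent used by `ℛ`. When m divides i r it is m rather than 0, which makes no difference
  -- modulo x^m - 1.
  rotation : ℕ → ℕ
  rotation i = m ∸ (i * r) % m

  -- p ≡ r modulo m, and rotation i ≡ − i r
  rotated : ∀ i s t → (i * p + (rotation i + (s * (r % m) + t))) % m ≡ (s * p + t) % m
  rotated i s t = begin
    (i * p + (a + (s * (r % m) + t))) % m
      ≡⟨ cong (λ x → (i * p + (a + (s * x + t))) % m) (m%n%n≡m%n p m) ⟩
    (i * p + (a + (s * r + t))) % m
      ≡⟨ [m+kn]%n≡m%n _ (s * Q) m ⟨
    (i * p + (a + (s * r + t)) + s * Q * m) % m
      ≡⟨ cong (_% m) shift ⟩
    (s * p + t + (i * Q + D + 1) * m) % m
      ≡⟨ [m+kn]%n≡m%n (s * p + t) (i * Q + D + 1) m ⟩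
    (s * p + t) % m ∎
    where
    open ≡-Reasoning
    a = rotation i
    Q = p / m
    ρ = (i * r) % m
    D = (i * r) / m
    expandˡ : ∀ i s t r Q m a → i * (r + Q * m) + (a + (s * r + t)) + s * Q * m
      ≡ i * r + a + i * Q * m + s * (r + Q * m) + t
    expandˡ = ℕ-Solver.solve-∀
    expandʳ : ∀ x t Y D ρ a → ρ + D * (a + ρ) + a + Y * (a + ρ) + x + t ≡ x + t + (Y + D + 1) * (a + ρ)
    expandʳ = ℕ-Solver.solve-∀
    p≡ : p ≡ r + Q * m
    p≡ = m≡m%n+[m/n]*n p m
    m≡ : a + ρ ≡ m
    m≡ = ℕ.m∸n+n≡m (m%n≤n (i * r) m)
    -- Adding s Q m trades s r for s p. On the right, i Q comes from i p = i r + i Q m, `D` is the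
    -- quotient of i r by m, and the 1 comes from a + ρ = m.
    shift : i * p + (a + (s * r + t)) + s * Q * m ≡ s * p + t + (i * Q + D + 1) * m
    shift = begin
      i * p + (a + (s * r + t)) + s * Q * m
        ≡⟨ cong (λ x → i * x + (a + (s * r + t)) + s * Q * m) p≡ ⟩
      i * (r + Q * m) + (a + (s * r + t)) + s * Q * m
        ≡⟨ expandˡ i s t r Q m a ⟩
      i * r + a + i * Q * m + s * (r + Q * m) + t
        ≡⟨ cong₂ (λ x y → x + a + i * Q * m + s * y + t) (m≡m%n+[m/n]*n (i * r) m) (sym p≡) ⟩
      ρ + D * m + a + i * Q * m + s * p + t
        ≡⟨ subst (λ M → ρ + D * M + a + i * Q * M + s * p + t ≡ s * p + t + (i * Q + D + 1) * M)
                 m≡ (expandʳ (s * p) t (i * Q) D ρ a) ⟩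
      s * p + t + (i * Q + D + 1) * m ∎

  -- The order condition of `residueBelow` is automatic here: s p ≤ i p ≤ n and t < m give s p + t <
  -- n + m, whereas a member of the class above n is at least n + m. Only a congruence modulo m
  -- remains, from which j m drops out.
  residues-agree : ∀ i j {k} → k < m → j * m + k < p → ∀ s → s < i + 1 → ∀ t → t < m →
    residue k (rotation i + (s * (r % m) + t)) ≡ residueBelow (i * p + (j * m + k)) (s * p + t)
  residues-agree i j {k} k<m jm+k<p s s≤i t t<m =
    𝟙-cong (w % m ℕ.≟ k) (ResidueBelow? n (s * p + t))
      (λ w≡k → let e≡n = begin
                     (s * p + t) % m   ≡⟨ rotated i s t ⟨
                     (i * p + w) % m   ≡⟨ %-congʳ-+ (i * p) (trans w≡k (sym k%m)) ⟩
                     (i * p + k) % m   ≡⟨ n%m ⟨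
                     n % m             ∎
               in below e≡n , e≡n)
      (λ (_ , e≡n) → trans (%-cancelˡ-+ (i * p) (begin
                     (i * p + w) % m   ≡⟨ rotated i s t ⟩
                     (s * p + t) % m   ≡⟨ e≡n ⟩
                     n % m             ≡⟨ n%m ⟩
                     (i * p + k) % m   ∎)) k%m)
    where
    open ≡-Reasoning
    w = rotation i + (s * (r % m) + t)
    n = i * p + (j * m + k)
    k%m : k % m ≡ k
    k%m = m<n⇒m%n≡m k<m
    rearrange : ∀ x y k → x + (y + k) ≡ x + k + y
    rearrange = ℕ-Solver.solve-∀
    n%m : n % m ≡ (i * p + k) % m
    n%m = trans (cong (_% m) (rearrange (i * p) (j * m) k)) ([m+kn]%n≡m%n (i * p + k) j m)
    sp≤n : s * p ≤ n
    sp≤n = ℕ.≤-trans (ℕ.*-monoˡ-≤ p (ℕ.≤-pred (subst (s <_) (ℕ.+-comm i 1) s≤i))) (ℕ.m≤m+n (i * p) _)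
    below : (s * p + t) % m ≡ n % m → s * p + t ≤ n
    below e≡n = ℕ.≮⇒≥ λ n<e → ℕ.<⇒≱ (ℕ.+-mono-≤-< sp≤n t<m) (%-gap n<e (sym e≡n))

  -- The exponent n lies in block i, hence below (i + 1) p ≤ s p.
  residues-vanish : ∀ i j {k} → j * m + k < p → ∀ s → i + 1 ≤ s → ∀ t →
    residueBelow (i * p + (j * m + k)) (s * p + t) ≡ 0ℤ
  residues-vanish i j {k} jm+k<p s i<s t = 𝟙-no (ResidueBelow? n (s * p + t)) λ (e≤n , _) →
    ℕ.<⇒≱ (begin-strict
      n               <⟨ ℕ.+-monoʳ-< (i * p) jm+k<p ⟩
      i * p + p       ≡⟨ rearrange i p ⟩
      (i + 1) * p     ≤⟨ ℕ.*-monoˡ-≤ p i<s ⟩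
      s * p           ≤⟨ ℕ.m≤m+n (s * p) t ⟩
      s * p + t       ∎) e≤n
    where
    open ℕ.≤-Reasoning
    n = i * p + (j * m + k)
    rearrange : ∀ i p → i * p + p ≡ (i + 1) * p
    rearrange = ℕ-Solver.solve-∀

  Φmp-*-xpowMinus1 : Φ (m * p) *ₚ xpowMinus1 m ≋ composeₚ (Φ m) (xpow p) *ₚ Ψ m
  Φmp-*-xpowMinus1 = begin
    Φ (m * p) *ₚ xpowMinus1 m              ≈⟨ *ₚ-cong (≋-refl {Φ (m * p)}) (Ψ-cofactor m 0<m) ⟨
    Φ (m * p) *ₚ (Φ m *ₚ Ψ m)              ≈⟨ *ₚ-assoc (Φ (m * p)) (Φ m) (Ψ m) ⟨
    Φ (m * p) *ₚ Φ m *ₚ Ψ m                ≈⟨ *ₚ-cong (Φ-*-prime p-prime m p∤m 0<m) (≋-refl {Ψ m}) ⟩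
    composeₚ (Φ m) (xpow p) *ₚ Ψ m         ∎
    where open ≋-Reasoning

  pairing-composeₚ-* : ∀ f e g s →
    ⟪ composeₚ f (xpow e) *ₚ g , s ⟫ ≡ ⟪ f , (λ a → ⟪ g , (λ b → s (a * e + b)) ⟫) ⟫
  pairing-composeₚ-* f e g s =
    trans (pairing-* (composeₚ f (xpow e)) g s) (pairing-composeₚ-xpow f e _)

  coeff-Φmp : ∀ n → ℤ.- coeff (Φ (m * p)) n ≡
    ⟪ Φ m , (λ s → ⟪ Ψ m , (λ t → residueBelow n (s * p + t)) ⟫) ⟫
  coeff-Φmp n = begin
    ℤ.- coeff (Φ (m * p)) n                                    ≡⟨ coeff-via-residueBelow (Φ (m * p)) n ⟨
    ⟪ Φ (m * p) *ₚ xpowMinus1 m , residueBelow n ⟫             ≡⟨ pairing≡ Φmp-*-xpowMinus1 (residueBelow n) ⟩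
    ⟪ composeₚ (Φ m) (xpow p) *ₚ Ψ m , residueBelow n ⟫
      ≡⟨ pairing-composeₚ-* (Φ m) p (Ψ m) (residueBelow n) ⟩
    ⟪ Φ m , (λ s → ⟪ Ψ m , (λ t → residueBelow n (s * p + t)) ⟫) ⟫ ∎
    where open ≡-Reasoning

  rotatedBlock : ℕ → Poly
  rotatedBlock i = ℛ m (i * r) (Ψ m *ₚ ℰ m r (𝒯 (i + 1) (Φ m)))

  -- Each operator moves onto the residue sequence: `ℛ` shifts it by `rotation i`, and `ℰ`
  -- multiplies s by `r % m`, since it reduces its index once more. Only `𝒯` stays with the
  -- polynomial, as `take`.
  coeff-rotatedBlock : ∀ i {k} → k < m → coeff (rotatedBlock i) k ≡
    ⟪ take (i + 1) (Φ m) , (λ s → ⟪ Ψ m , (λ t → residue k (rotation i + (s * (r % m) + t))) ⟫) ⟫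
  coeff-rotatedBlock i {k} k<m = begin
    coeff (rotatedBlock i) k
      ≡⟨ coeff-via-residue (xpow (rotation i) *ₚ (Ψ m *ₚ E)) k<m ⟩
    ⟪ xpow (rotation i) *ₚ (Ψ m *ₚ E) , residue k ⟫
      ≡⟨ trans (pairing-* (xpow (rotation i)) (Ψ m *ₚ E) (residue k))
               (pairing-xpow (rotation i) (λ a → ⟪ Ψ m *ₚ E , (λ e → residue k (a + e)) ⟫)) ⟩
    ⟪ Ψ m *ₚ E , (λ e → residue k (rotation i + e)) ⟫
      ≡⟨ pairing≡ (*ₚ-comm (Ψ m) E) _ ⟩
    ⟪ E *ₚ Ψ m , (λ e → residue k (rotation i + e)) ⟫
      ≡⟨ pairing-composeₚ-* (𝒯 (i + 1) (Φ m)) (r % m) (Ψ m) _ ⟩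
    ⟪ 𝒯 (i + 1) (Φ m) , (λ s → ⟪ Ψ m , (λ t → residue k (rotation i + (s * (r % m) + t))) ⟫) ⟫
      ≡⟨ pairing≡ (𝒯-take (i + 1) (Φ m)) _ ⟩
    ⟪ take (i + 1) (Φ m) , (λ s → ⟪ Ψ m , (λ t → residue k (rotation i + (s * (r % m) + t))) ⟫) ⟫ ∎
    where
    open ≡-Reasoning
    E = ℰ m r (𝒯 (i + 1) (Φ m))

  coeff-Φmp-block : ∀ i j {k} → k < m → j * m + k < p →
    coeff (Φ (m * p)) (i * p + (j * m + k)) ≡ ℤ.- coeff (rotatedBlock i) k
  coeff-Φmp-block i j {k} k<m jm+k<p = begin
    coeff (Φ (m * p)) n              ≡⟨ ℤ.neg-involutive _ ⟨
    ℤ.- ℤ.- coeff (Φ (m * p)) n      ≡⟨ cong ℤ.-_ (trans (coeff-Φmp n) (sym (trans (coeff-rotatedBlock i k<m)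
      (pairing-take (i + 1) (Φ m)
        (λ s s≤i → pairing-congʳ-supp (Ψ m) (Ψ-agree s s≤i))
        (λ s i<s → pairing-zero (Ψ m) (λ t → inj₂ (residues-vanish i j jm+k<p s i<s t))))))) ⟩
    ℤ.- coeff (rotatedBlock i) k     ∎
    where
    open ≡-Reasoning
    n = i * p + (j * m + k)
    Ψ-agree : ∀ s → s < i + 1 → ∀ t → coeff (Ψ m) t ≡ 0ℤ ⊎
      residue k (rotation i + (s * (r % m) + t)) ≡ residueBelow n (s * p + t)
    Ψ-agree s s≤i t with m ℕ.≤? t
    ... | yes m≤t = inj₁ (Ψ-degree m 0<m m-sqfree m≤t)
    ... | no  m≰t = inj₂ (residues-agree i j k<m jm+k<p s s≤i t (ℕ.≰⇒> m≰t))

  -- Asking for j m + k < p instead of j < q makes one formula serve the full blocks and also the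
  -- first r coefficients of the last one.
  coeff-fblock2 : ∀ i j {k} → k < m → j * m + k < p →
    coeff (fblock2 m p i j) k ≡ ℤ.- coeff (rotatedBlock i) k
  coeff-fblock2 i j {k} k<m jm+k<p = begin
    coeff (block (fblock m p i) m j) k         ≡⟨ coeff-block-< (fblock m p i) j k<m ⟩
    coeff (block (Φ (m * p)) p i) (j * m + k)  ≡⟨ coeff-block-< (Φ (m * p)) i jm+k<p ⟩
    coeff (Φ (m * p)) (i * p + (j * m + k))    ≡⟨ coeff-Φmp-block i j k<m jm+k<p ⟩
    ℤ.- coeff (rotatedBlock i) k               ∎
    where open ≡-Reasoning

  initial-block : ∀ i j → j < p / m → fblock2 m p i j ≈ₚ negₚ (rotatedBlock i)
  initial-block i j j<q k with k ℕ.<? m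
  ... | yes k<m = trans (coeff-fblock2 i j k<m (begin-strict
      j * m + k      <⟨ ℕ.+-monoʳ-< (j * m) k<m ⟩
      j * m + m      ≡⟨ ℕ.+-comm (j * m) m ⟩
      suc j * m      ≤⟨ ℕ.*-monoˡ-≤ m j<q ⟩
      p / m * m      ≤⟨ m/n*n≤m p m ⟩
      p              ∎)) (sym (coeff-neg (rotatedBlock i) k))
    where open ℕ.≤-Reasoning
  ... | no  k≮m = trans (coeff-block-≥ (fblock m p i) j (ℕ.≮⇒≥ k≮m)) (sym (trans
      (coeff-neg (rotatedBlock i) k)
      (cong ℤ.-_ (remₚ-degree (xpow (rotation i) *ₚ (Ψ m *ₚ ℰ m r (𝒯 (i + 1) (Φ m)))) (xpowMinus1 m) (monic-xpowMinus1 0<m) (ℕ.≮⇒≥ k≮m)))))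

  -- As p = q m + r, block q holds only r coefficients. Those agree with the ones of block 0 because
  -- both are given by the same formula, which does not involve j; from r on, the exponent q m + k
  -- has left the block of length p.
  last-block : ∀ i → fblock2 m p i (p / m) ≈ₚ 𝒯 r (fblock2 m p i 0)
  last-block i k = trans (cases (k ℕ.<? r)) (sym (≋⇒≈ₚ (𝒯-take r (fblock2 m p i 0)) k))
    where
    q = p / m
    p≡ : q * m + r ≡ p
    p≡ = trans (ℕ.+-comm (q * m) r) (sym (m≡m%n+[m/n]*n p m))
    cases : Dec (k < r) → coeff (fblock2 m p i q) k ≡ coeff (take r (fblock2 m p i 0)) k
    cases (yes k<r) = trans
      (coeff-fblock2 i q k<m (subst (q * m + k <_) p≡ (ℕ.+-monoʳ-< (q * m) k<r)))
      (sym (trans (coeff-take-< (fblock2 m p i 0) k<r)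
                  (coeff-fblock2 i 0 k<m (ℕ.<-≤-trans k<r (m%n≤m p m)))))
      where
      k<m : k < m
      k<m = ℕ.<-trans k<r (m%n<n p m)
    cases (no k≮r) = trans tail (sym (coeff-take-≥ (fblock2 m p i 0) (ℕ.≮⇒≥ k≮r)))
      where
      tail : coeff (fblock2 m p i q) k ≡ 0ℤ
      tail with k ℕ.<? m
      ... | yes k<m = trans (coeff-block-< (fblock m p i) q k<m)
        (coeff-block-≥ (Φ (m * p)) i (subst (_≤ q * m + k) p≡ (ℕ.+-monoʳ-≤ (q * m) (ℕ.≮⇒≥ k≮r))))
      ... | no  k≮m = coeff-block-≥ (fblock m p i) q (ℕ.≮⇒≥ k≮m)

mainTheorem1 : (m p : ℕ) .{{_ : NonZero m}} →
    ¬ (2 ∣ m) →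
    (∀ d → d * d ∣ m → d ≡ 1) →
    Prime p →
    gcd p m ≡ 1 →
    (i j : ℕ) → i ≤ φ m ∸ 1 → j ≤ p / m →
    (j < p / m →
    fblock2 m p i j ≈ₚ negₚ (ℛ m (i * (p % m)) (Ψ m *ₚ ℰ m (p % m) (𝒯 (i + 1) (Φ m)))))
    × (j ≡ p / m → fblock2 m p i j ≈ₚ 𝒯 (p % m) (fblock2 m p i 0))
mainTheorem1 m p _ m-sqfree p-prime gcd≡1 i j _ _ = initial-block i j , λ { refl → last-block i }
  where
  p∤m : ¬ p ∣ m
  p∤m p∣m = ¬prime[1] (subst Prime (∣1⇒≡1 (subst (p ∣_) gcd≡1 (gcd-greatest ∣-refl p∣m))) p-prime)
  open Blocks m p m-sqfree p-prime p∤m
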